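{- Let $d\geq 1$, $r\geq d+1$, $1\leq m\leq r$ and $m\leq k\leq \min\{m+d,r\}$ be integers. Let $V$ be a finite set with $|V|\geq \max\{m+d,r\}$. Let $X$ be a $d$-Leray simplicial complex on vertex set $V$, and let $M$ be a matroid of rank $r$ on $V$ with rank function $\rho$. Assume that for every set $U=\{u_1,\ldots,u_{d+1},v_1,\ldots,v_{m-1}\}\subset V$ (of $d+m$ distinct elements) with $\rho(U)\geq k$, either $\{u_1,\ldots,u_{d+1}\}\in X$ or there exists $j\in\{1,\ldots,m-1\}$ such that $\sigma\cup\{v_j\}\in X$ for every $\sigma\subsetneq \{u_1,\ldots,u_{d+1}\}$. Then there is some $\tau\in X$ such that $\rho(V\setminus\tau)\leq k-1$.
   Context: A simplicial complex $X$ on vertex set $V$ is a family of subsets of the finite set $V$ closed under taking subsets. For $U\subset V$, the induced subcomplex is $X[U]=\{\sigma\in X:\sigma\subset U\}$. $X$ is $d$-Leray if every induced subcomplex $X[U]$ (including $X$ itself) has trivial reduced homology $\tilde H_i$ for all $i\geq d$. For a matroid $M$ on $V$, the rank function $\rho$ assigns to $W\subset V$ the maximum size of an independent subset of $W$; the rank of $M$ is $\rho(V)$. -}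

module Defs where

open import Data.Nat using (ℕ; zero; suc; _⊔_; _≤_)
open import Data.Bool using (Bool; true; false; if_then_else_; _∧_; T)
open import Data.Fin using (Fin; zero; suc; toℕ)
open import Data.Fin.Subset
open import Data.Fin.Subset.Properties using (_⊆?_)
open import Data.Vec using (Vec; []; _∷_; lookup; tabulate)
open import Data.List using (List; []; _∷_; map; _++_; foldr)
open import Data.Rational using (ℚ; 0ℚ; 1ℚ; -_; _+_; _*_)
open import Data.Product using (Σ; ∃; _×_; _,_)
open import Data.Nat using (_<ᵇ_)
open import Relation.Nullary using (¬_)
open import Relation.Nullary.Decidable using (⌊_⌋)
open import Relation.Binary.PropositionalEquality using (_≡_)

IsSimplicialComplex : {n : ℕ} → (Subset n → Set) → Set
IsSimplicialComplex {n} X = ∀ (σ τ : Subset n) → σ ⊆ τ → X τ → X σ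

-- Simplicial chains with rational coefficients.
-- A chain is a function from faces (subsets) to ℚ; faces are oriented
-- by the natural order of Fin n.

sumFin : (n : ℕ) → (Fin n → ℚ) → ℚ
sumFin zero    f = 0ℚ
sumFin (suc n) f = f zero + sumFin n (λ i → f (suc i))

signℚ : ℕ → ℚ
signℚ zero    = 1ℚ
signℚ (suc k) = - signℚ k

below : {n : ℕ} → Fin n → Subset n → ℕ
below {n} v τ = ∣ τ ∩ tabulate (λ u → toℕ u <ᵇ toℕ v) ∣

-- boundary operator: (∂ c)(τ) = Σ_{v ∉ τ} (-1)^{#{u ∈ τ : u < v}} c(τ ∪ {v}),
-- i.e. the usual ∂[v₀,…,v_i] = Σ_j (-1)^j [v₀,…,v̂_j,…,v_i].
-- On 0-chains it is the augmentation (value at the empty face), so the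
-- resulting homology is reduced homology.
∂ : {n : ℕ} → (Subset n → ℚ) → (Subset n → ℚ)
∂ {n} c τ = sumFin n (λ v → if lookup τ v then 0ℚ else signℚ (below v τ) * c (τ ∪ ⁅ v ⁆))

IsChain : {n : ℕ} → (Subset n → Set) → Subset n → ℕ → (Subset n → ℚ) → Set
IsChain X U i c = ∀ σ → ¬ (c σ ≡ 0ℚ) → X σ × σ ⊆ U × ∣ σ ∣ ≡ suc i

ReducedHomologyVanishes : {n : ℕ} → (Subset n → Set) → Subset n → ℕ → Set
ReducedHomologyVanishes {n} X U i =
  ∀ (c : Subset n → ℚ) → IsChain X U i c → (∀ τ → ∂ c τ ≡ 0ℚ) →
  ∃ λ (b : Subset n → ℚ) → IsChain X U (suc i) b × (∀ τ → ∂ b τ ≡ c τ)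

IsLeray : {n : ℕ} → (Subset n → Set) → ℕ → Set
IsLeray {n} X d = ∀ (U : Subset n) (i : ℕ) → d ≤ i → ReducedHomologyVanishes X U i

IsMatroid : {n : ℕ} → (Subset n → Bool) → Set
IsMatroid {n} I =
  T (I ⊥) ×
  (∀ (A B : Subset n) → A ⊆ B → T (I B) → T (I A)) ×
  (∀ (A B : Subset n) → T (I A) → T (I B) → Data.Nat._<_ ∣ A ∣ ∣ B ∣ →
     ∃ λ x → x ∈ B × x ∉ A × T (I (A ∪ ⁅ x ⁆)))

allSubsets : (n : ℕ) → List (Subset n)
allSubsets zero    = [] ∷ []
allSubsets (suc n) = map (outside ∷_) (allSubsets n) ++ map (inside ∷_) (allSubsets n)

rank : {n : ℕ} → (Subset n → Bool) → Subset n → ℕ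
rank {n} I W =
  foldr _⊔_ 0 (map (λ S → if I S ∧ ⌊ S ⊆? W ⌋ then ∣ S ∣ else 0) (allSubsets n))

{-# OPTIONS --safe #-}
module Submission where

-- Suppose ρ(V ∖ τ) ≥ k for all τ ∈ X. The cubes [T, τ] = {σ : T ⊆ σ ⊆ τ} with τ ∈ X subdivide a cone over
-- X; each is sent to a chain f[T, τ] of dimension |τ ∖ T| in X[V ∖ T] so that ∂ f = f ∂. By induction on
-- q = |τ ∖ T| this amounts to filling (q - 1)-cycles of X[V ∖ T]. For q < d they are filled among the
-- independent sets of an elongation of M, whose members of size at most d lie in X by hypothesis. For
-- q = d the filling consists of independent sets A of size d + 1, and the hypothesis fills each sphere
-- ∂A in X[V ∖ T]; when |V ∖ T| < d + m it may fail to, but then the Leray property applied to spheres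
-- ∂A * ∂T₀ yields a face of X whose complement has fewer than m elements. For q > d one uses that X is
-- d-Leray.
-- Put h(τ) = f[∅, τ]. As f[{u}, τ] avoids u, the coefficient of τ in ∂h(τ) equals that in h(∂τ) when
-- τ ≠ ∅, whereas these coefficients are 1 and 0 for τ = ∅. This contradicts tr(∂h) = tr(h∂).
--
-- X is not assumed decidable, so "∃ τ" cannot be obtained by refuting its negation; instead the classical
-- argument is run in the continuation monad K whose answer type R is the conclusion itself.

open import Defs
open import Data.Nat using (ℕ; _≤_; _+_; _∸_)
open import Data.Bool using (Bool)
open import Data.Fin.Subset using (Subset; _∈_; _⊂_; _∪_; _∩_; ⁅_⁆; ∁; ⊤; ∣_∣; Empty)
open import Data.Product using (∃; _×_)
open import Data.Sum using (_⊎_)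
open import Relation.Binary.PropositionalEquality using (_≡_)

open import Data.Bool using (true; false; if_then_else_; T; _∧_)
open import Data.Empty as Empty using (⊥-elim)
open import Data.Fin using (Fin; zero; suc)
open import Data.Fin.Properties using (any?; all?)
open import Data.Fin.Subset using (inside; outside; ⊥; _∉_; _⊆_; _─_; _-_)
open import Data.Fin.Subset.Properties
import Data.List as List
open import Data.List.Membership.Propositional using () renaming (_∈_ to _∈ₗ_)
open import Data.List.Membership.Propositional.Properties using (∈-++⁺ˡ; ∈-++⁺ʳ; ∈-map⁺)
import Data.List.Relation.Unary.Any as Any
open import Data.Nat as ℕ using (zero; suc; _⊔_; _<_; _≤?_; s≤s; s≤s⁻¹; z≤n)
import Data.Nat.Properties as ℕ
open import Data.Product using (_,_; proj₁; proj₂)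
open import Data.Rational as ℚ using (ℚ; 0ℚ; 1ℚ; _*_; -_)
import Data.Rational.Properties as ℚ
open import Data.Sum using (inj₁; inj₂; [_,_]′)
open import Data.Unit using (tt) renaming (⊤ to Unit)
open import Data.Vec using (Vec; []; _∷_; lookup; tabulate; here; there)
open import Data.Vec.Properties using (lookup∘tabulate; []=⇒lookup; lookup⇒[]=)
open import Function using (_∘_)
open import Relation.Binary.Definitions using (tri<; tri≈; tri>)
open import Relation.Binary.PropositionalEquality
  using (refl; sym; trans; cong; cong₂; subst; subst₂; module ≡-Reasoning)
open import Relation.Nullary using (¬_; Dec; yes; no)
open import Relation.Nullary.Decidable
  using (dec⇒maybe; decidable-stable; dec-true; does; _×-dec_; _→-dec_; _⊎-dec_; ¬?; ⌊_⌋)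
open import Relation.Unary using (Decidable)
open import Tactic.RingSolver using (solve-∀)
open import Tactic.RingSolver.Core.AlmostCommutativeRing
  using (AlmostCommutativeRing; fromCommutativeRing)

ℚ-ring : AlmostCommutativeRing _ _
ℚ-ring = fromCommutativeRing ℚ.+-*-commutativeRing (λ x → dec⇒maybe (0ℚ ℚ.≟ x))

-- Simplicial chains

Chain : ℕ → Set
Chain n = Subset n → ℚ

_⁰ _¹ : ∀ {n} → Chain (suc n) → Chain n
(c ⁰) t = c (outside ∷ t)
(c ¹) t = c (inside ∷ t)

bd : ∀ {n} → Chain n → Chain n
bd c []            = 0ℚ
bd c (outside ∷ s) = c (inside ∷ s) ℚ.+ bd (c ⁰) s
bd c (inside ∷ s)  = - bd (c ¹) s

-- ι e and κ e are the contraction with e and the exterior product with e.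

ι : ∀ {n} → Fin n → Chain n → Chain n
ι zero    c (outside ∷ s) = c (inside ∷ s)
ι zero    c (inside ∷ s)  = 0ℚ
ι (suc e) c (outside ∷ s) = ι e (c ⁰) s
ι (suc e) c (inside ∷ s)  = - ι e (c ¹) s

κ : ∀ {n} → Fin n → Chain n → Chain n
κ zero    c (outside ∷ s) = 0ℚ
κ zero    c (inside ∷ s)  = c (outside ∷ s)
κ (suc e) c (outside ∷ s) = κ e (c ⁰) s
κ (suc e) c (inside ∷ s)  = - κ e (c ¹) s

sumFin-cong : ∀ n {f g : Fin n → ℚ} → (∀ i → f i ≡ g i) → sumFin n f ≡ sumFin n g
sumFin-cong zero    f≗g = refl
sumFin-cong (suc n) f≗g = cong₂ ℚ._+_ (f≗g zero) (sumFin-cong n (λ i → f≗g (suc i)))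

sumFin-neg : ∀ n (f : Fin n → ℚ) → sumFin n (λ i → - f i) ≡ - sumFin n f
sumFin-neg zero    f = refl
sumFin-neg (suc n) f = trans (cong (- f zero ℚ.+_) (sumFin-neg n _)) (sym (ℚ.neg-distrib-+ (f zero) _))

∩-tabulate-outside : ∀ {n} (s : Subset n) → ∣ s ∩ tabulate (λ _ → outside) ∣ ≡ 0
∩-tabulate-outside []            = refl
∩-tabulate-outside (outside ∷ s) = ∩-tabulate-outside s
∩-tabulate-outside (inside ∷ s)  = ∩-tabulate-outside s

∂≡bd : ∀ {n} (c : Chain n) τ → ∂ c τ ≡ bd c τ
∂≡bd c []            = refl
∂≡bd {suc n} c (outside ∷ s) = cong₂ ℚ._+_ head (∂≡bd (c ⁰) s)
  where
  head : signℚ (below zero (outside ∷ s)) * c (inside ∷ (s ∪ ⊥)) ≡ c (inside ∷ s)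
  head rewrite ∩-tabulate-outside s | ∪-identityʳ s = ℚ.*-identityˡ _
∂≡bd {suc n} c (inside ∷ s) = trans (ℚ.+-identityˡ _)
  (trans (sumFin-cong n flip-sign) (trans (sumFin-neg n _) (cong -_ (∂≡bd (c ¹) s))))
  where
  flip-sign : ∀ v →
    (if lookup s v then 0ℚ else (- signℚ (below v s)) * c (inside ∷ (s ∪ ⁅ v ⁆))) ≡
    - (if lookup s v then 0ℚ else signℚ (below v s) * c (inside ∷ (s ∪ ⁅ v ⁆)))
  flip-sign v with lookup s v
  ... | true  = refl
  ... | false = sym (ℚ.neg-distribˡ-* (signℚ (below v s)) _)

bd-cong : ∀ {n} {x y : Chain n} → (∀ σ → x σ ≡ y σ) → ∀ τ → bd x τ ≡ bd y τ
bd-cong x≗y []            = refl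
bd-cong x≗y (outside ∷ s) = cong₂ ℚ._+_ (x≗y _) (bd-cong (λ t → x≗y (outside ∷ t)) s)
bd-cong x≗y (inside ∷ s)  = cong -_ (bd-cong (λ t → x≗y (inside ∷ t)) s)

bd-0 : ∀ {n} (τ : Subset n) → bd (λ _ → 0ℚ) τ ≡ 0ℚ
bd-0 []            = refl
bd-0 (outside ∷ s) = trans (ℚ.+-identityˡ _) (bd-0 s)
bd-0 (inside ∷ s)  = cong -_ (bd-0 s)

interchange : ∀ a b c d → (a ℚ.+ b) ℚ.+ (c ℚ.+ d) ≡ (a ℚ.+ c) ℚ.+ (b ℚ.+ d)
interchange = solve-∀ ℚ-ring

bd-+ : ∀ {n} (x y : Chain n) τ → bd (λ σ → x σ ℚ.+ y σ) τ ≡ bd x τ ℚ.+ bd y τ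
bd-+ x y []            = refl
bd-+ x y (outside ∷ s) =
  trans (cong (x (inside ∷ s) ℚ.+ y (inside ∷ s) ℚ.+_) (bd-+ _ _ s)) (interchange (x (inside ∷ s)) _ _ _)
bd-+ x y (inside ∷ s)  = trans (cong -_ (bd-+ (x ¹) (y ¹) s)) (ℚ.neg-distrib-+ (bd (x ¹) s) _)

bd-neg : ∀ {n} (x : Chain n) τ → bd (λ σ → - x σ) τ ≡ - bd x τ
bd-neg x []            = refl
bd-neg x (outside ∷ s) =
  trans (cong (- x (inside ∷ s) ℚ.+_) (bd-neg _ s)) (sym (ℚ.neg-distrib-+ (x (inside ∷ s)) _))
bd-neg x (inside ∷ s)  = cong -_ (bd-neg _ s)

bd-* : ∀ {n} q (x : Chain n) τ → bd (λ σ → q * x σ) τ ≡ q * bd x τ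
bd-* q x []            = sym (ℚ.*-zeroʳ q)
bd-* q x (outside ∷ s) =
  trans (cong (q * x (inside ∷ s) ℚ.+_) (bd-* q _ s)) (sym (ℚ.*-distribˡ-+ q _ _))
bd-* q x (inside ∷ s)  = trans (cong -_ (bd-* q _ s)) (ℚ.neg-distribʳ-* q _)

ι-+ : ∀ {n} e (x y : Chain n) τ → ι e (λ σ → x σ ℚ.+ y σ) τ ≡ ι e x τ ℚ.+ ι e y τ
ι-+ zero    x y (outside ∷ s) = refl
ι-+ zero    x y (inside ∷ s)  = refl
ι-+ (suc e) x y (outside ∷ s) = ι-+ e _ _ s
ι-+ (suc e) x y (inside ∷ s)  = trans (cong -_ (ι-+ e (x ¹) (y ¹) s)) (ℚ.neg-distrib-+ (ι e (x ¹) s) _)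

ι-neg : ∀ {n} e (x : Chain n) τ → ι e (λ σ → - x σ) τ ≡ - ι e x τ
ι-neg zero    x (outside ∷ s) = refl
ι-neg zero    x (inside ∷ s)  = refl
ι-neg (suc e) x (outside ∷ s) = ι-neg e _ s
ι-neg (suc e) x (inside ∷ s)  = cong -_ (ι-neg e _ s)

ι-0 : ∀ {n} e {x : Chain n} → (∀ σ → x σ ≡ 0ℚ) → ∀ τ → ι e x τ ≡ 0ℚ
ι-0 zero    x≗0 (outside ∷ s) = x≗0 _
ι-0 zero    x≗0 (inside ∷ s)  = refl
ι-0 (suc e) x≗0 (outside ∷ s) = ι-0 e (λ t → x≗0 _) s
ι-0 (suc e) x≗0 (inside ∷ s)  = cong -_ (ι-0 e (λ t → x≗0 _) s)

κ-+ : ∀ {n} e (x y : Chain n) τ → κ e (λ σ → x σ ℚ.+ y σ) τ ≡ κ e x τ ℚ.+ κ e y τ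
κ-+ zero    x y (outside ∷ s) = refl
κ-+ zero    x y (inside ∷ s)  = refl
κ-+ (suc e) x y (outside ∷ s) = κ-+ e _ _ s
κ-+ (suc e) x y (inside ∷ s)  = trans (cong -_ (κ-+ e (x ¹) (y ¹) s)) (ℚ.neg-distrib-+ (κ e (x ¹) s) _)

κ-neg : ∀ {n} e (x : Chain n) τ → κ e (λ σ → - x σ) τ ≡ - κ e x τ
κ-neg zero    x (outside ∷ s) = refl
κ-neg zero    x (inside ∷ s)  = refl
κ-neg (suc e) x (outside ∷ s) = κ-neg e _ s
κ-neg (suc e) x (inside ∷ s)  = cong -_ (κ-neg e _ s)

κ-0 : ∀ {n} e {x : Chain n} → (∀ σ → x σ ≡ 0ℚ) → ∀ τ → κ e x τ ≡ 0ℚ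
κ-0 zero    x≗0 (outside ∷ s) = refl
κ-0 zero    x≗0 (inside ∷ s)  = x≗0 _
κ-0 (suc e) x≗0 (outside ∷ s) = κ-0 e (λ t → x≗0 _) s
κ-0 (suc e) x≗0 (inside ∷ s)  = cong -_ (κ-0 e (λ t → x≗0 _) s)

bd-bd : ∀ {n} (c : Chain n) τ → bd (bd c) τ ≡ 0ℚ
bd-bd c []            = refl
bd-bd c (outside ∷ s) = begin
  - bd (c ¹) s ℚ.+ bd (λ t → c (inside ∷ t) ℚ.+ bd (c ⁰) t) s
    ≡⟨ cong (- bd (c ¹) s ℚ.+_) (bd-+ (c ¹) (bd (c ⁰)) s) ⟩
  - bd (c ¹) s ℚ.+ (bd (c ¹) s ℚ.+ bd (bd (c ⁰)) s)
    ≡⟨ cong (λ z → - bd (c ¹) s ℚ.+ (bd (c ¹) s ℚ.+ z)) (bd-bd (c ⁰) s) ⟩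
  - bd (c ¹) s ℚ.+ (bd (c ¹) s ℚ.+ 0ℚ)  ≡⟨ cancel (bd (c ¹) s) ⟩
  0ℚ                                    ∎
  where
  open ≡-Reasoning
  cancel : ∀ a → - a ℚ.+ (a ℚ.+ 0ℚ) ≡ 0ℚ
  cancel = solve-∀ ℚ-ring
bd-bd c (inside ∷ s) = cong -_ (trans (bd-neg (bd (c ¹)) s) (cong -_ (bd-bd (c ¹) s)))

bd-κ : ∀ {n} e (c : Chain n) τ → bd (κ e c) τ ℚ.+ κ e (bd c) τ ≡ c τ
bd-κ zero c (outside ∷ s) =
  trans (cong (λ z → c (outside ∷ s) ℚ.+ z ℚ.+ 0ℚ) (bd-0 s)) (simplify (c (outside ∷ s)))
  where
  simplify : ∀ a → a ℚ.+ 0ℚ ℚ.+ 0ℚ ≡ a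
  simplify = solve-∀ ℚ-ring
bd-κ zero c (inside ∷ s) = simplify (bd (c ⁰) s) (c (inside ∷ s))
  where
  simplify : ∀ a b → - a ℚ.+ (b ℚ.+ a) ≡ b
  simplify = solve-∀ ℚ-ring
bd-κ (suc e) c (outside ∷ s) = begin
  - κ e (c ¹) s ℚ.+ bd (κ e (c ⁰)) s ℚ.+ κ e (λ t → c (inside ∷ t) ℚ.+ bd (c ⁰) t) s
    ≡⟨ cong (- κ e (c ¹) s ℚ.+ bd (κ e (c ⁰)) s ℚ.+_) (κ-+ e (c ¹) (bd (c ⁰)) s) ⟩
  - κ e (c ¹) s ℚ.+ bd (κ e (c ⁰)) s ℚ.+ (κ e (c ¹) s ℚ.+ κ e (bd (c ⁰)) s)
    ≡⟨ cancel (κ e (c ¹) s) _ _ ⟩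
  bd (κ e (c ⁰)) s ℚ.+ κ e (bd (c ⁰)) s  ≡⟨ bd-κ e (c ⁰) s ⟩
  c (outside ∷ s)                        ∎
  where
  open ≡-Reasoning
  cancel : ∀ a b d → - a ℚ.+ b ℚ.+ (a ℚ.+ d) ≡ b ℚ.+ d
  cancel = solve-∀ ℚ-ring
bd-κ (suc e) c (inside ∷ s) = begin
  - bd (λ t → - κ e (c ¹) t) s ℚ.+ - κ e (λ t → - bd (c ¹) t) s
    ≡⟨ cong₂ (λ a b → - a ℚ.+ - b) (bd-neg (κ e (c ¹)) s) (κ-neg e (bd (c ¹)) s) ⟩
  - - bd (κ e (c ¹)) s ℚ.+ - - κ e (bd (c ¹)) s
    ≡⟨ cong₂ ℚ._+_ (neg-neg (bd (κ e (c ¹)) s)) (neg-neg (κ e (bd (c ¹)) s)) ⟩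
  bd (κ e (c ¹)) s ℚ.+ κ e (bd (c ¹)) s  ≡⟨ bd-κ e (c ¹) s ⟩
  c (inside ∷ s)                         ∎
  where
  open ≡-Reasoning
  neg-neg : ∀ a → - - a ≡ a
  neg-neg = solve-∀ ℚ-ring

bd-ι : ∀ {n} e (c : Chain n) τ → bd (ι e c) τ ≡ - ι e (bd c) τ
bd-ι zero c (outside ∷ s) = simplify (bd (c ¹) s)
  where
  simplify : ∀ a → 0ℚ ℚ.+ a ≡ - - a
  simplify = solve-∀ ℚ-ring
bd-ι zero c (inside ∷ s) = cong -_ (bd-0 s)
bd-ι (suc e) c (outside ∷ s) = begin
  - ι e (c ¹) s ℚ.+ bd (ι e (c ⁰)) s             ≡⟨ cong (- ι e (c ¹) s ℚ.+_) (bd-ι e (c ⁰) s) ⟩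
  - ι e (c ¹) s ℚ.+ - ι e (bd (c ⁰)) s           ≡⟨ sym (ℚ.neg-distrib-+ (ι e (c ¹) s) _) ⟩
  - (ι e (c ¹) s ℚ.+ ι e (bd (c ⁰)) s)           ≡⟨ cong -_ (sym (ι-+ e (c ¹) (bd (c ⁰)) s)) ⟩
  - ι e (λ t → c (inside ∷ t) ℚ.+ bd (c ⁰) t) s ∎
  where open ≡-Reasoning
bd-ι (suc e) c (inside ∷ s) = cong -_ (begin
  bd (λ t → - ι e (c ¹) t) s    ≡⟨ bd-neg (ι e (c ¹)) s ⟩
  - bd (ι e (c ¹)) s            ≡⟨ cong -_ (bd-ι e (c ¹) s) ⟩
  - - ι e (bd (c ¹)) s          ≡⟨ cong -_ (sym (ι-neg e (bd (c ¹)) s)) ⟩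
  - ι e (λ t → - bd (c ¹) t) s ∎)
  where open ≡-Reasoning

ικ+κι : ∀ {n} e (c : Chain n) τ → ι e (κ e c) τ ℚ.+ κ e (ι e c) τ ≡ c τ
ικ+κι zero    c (outside ∷ s) = ℚ.+-identityʳ _
ικ+κι zero    c (inside ∷ s)  = ℚ.+-identityˡ _
ικ+κι (suc e) c (outside ∷ s) = ικ+κι e _ s
ικ+κι (suc e) c (inside ∷ s)  = begin
  - ι e (λ t → - κ e (c ¹) t) s ℚ.+ - κ e (λ t → - ι e (c ¹) t) s
    ≡⟨ cong₂ (λ a b → - a ℚ.+ - b) (ι-neg e (κ e (c ¹)) s) (κ-neg e (ι e (c ¹)) s) ⟩
  - - ι e (κ e (c ¹)) s ℚ.+ - - κ e (ι e (c ¹)) s  ≡⟨ neg-neg (ι e (κ e (c ¹)) s) _ ⟩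
  ι e (κ e (c ¹)) s ℚ.+ κ e (ι e (c ¹)) s          ≡⟨ ικ+κι e (c ¹) s ⟩
  c (inside ∷ s)                                   ∎
  where
  open ≡-Reasoning
  neg-neg : ∀ a b → - - a ℚ.+ - - b ≡ a ℚ.+ b
  neg-neg = solve-∀ ℚ-ring

Supp : ∀ {n} → (Subset n → Set) → Chain n → Set
Supp P c = ∀ σ → ¬ (c σ ≡ 0ℚ) → P σ

+-≢0 : ∀ {P : Set} a b → (¬ a ≡ 0ℚ → P) → (¬ b ≡ 0ℚ → P) → ¬ a ℚ.+ b ≡ 0ℚ → P
+-≢0 a b f g a+b≢0 with a ℚ.≟ 0ℚ | b ℚ.≟ 0ℚ
... | no  a≢0 | _       = f a≢0
... | yes _   | no  b≢0 = g b≢0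
... | yes a≡0 | yes b≡0 = ⊥-elim (a+b≢0 (cong₂ ℚ._+_ a≡0 b≡0))

neg-≢0 : ∀ {a} → ¬ - a ≡ 0ℚ → ¬ a ≡ 0ℚ
neg-≢0 -a≢0 a≡0 = -a≢0 (cong -_ a≡0)

bd-supp : ∀ {n} (c : Chain n) τ → ¬ bd c τ ≡ 0ℚ → ∃ λ x → x ∉ τ × ¬ c (τ ∪ ⁅ x ⁆) ≡ 0ℚ
bd-supp c [] ≢0 = ⊥-elim (≢0 refl)
bd-supp {suc n} c (outside ∷ s) = +-≢0 (c (inside ∷ s)) _
  (λ c≢0 → zero , (λ ()) , λ eq → c≢0 (trans (cong (c ¹) (sym (∪-identityʳ s))) eq))
  (λ bd≢0 → let x , x∉s , c≢0 = bd-supp _ s bd≢0 in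
    suc x , (λ { (there x∈s) → x∉s x∈s }) , c≢0)
bd-supp c (inside ∷ s) ≢0 = let x , x∉s , c≢0 = bd-supp _ s (neg-≢0 ≢0) in
    suc x , (λ { (there x∈s) → x∉s x∈s }) , c≢0

κ-supp : ∀ {n} e (c : Chain n) σ → ¬ κ e c σ ≡ 0ℚ → e ∈ σ × ¬ c (σ - e) ≡ 0ℚ
κ-supp zero    c (outside ∷ s) ≢0 = ⊥-elim (≢0 refl)
κ-supp zero    c (inside ∷ s)  ≢0 = here , λ eq → ≢0 (trans (cong (c ⁰) (sym (p─⊥≡p s))) eq)
κ-supp (suc e) c (outside ∷ s) ≢0 = let e∈s , c≢0 = κ-supp e _ s ≢0 in there e∈s , c≢0
κ-supp (suc e) c (inside ∷ s)  ≢0 = let e∈s , c≢0 = κ-supp e _ s (neg-≢0 ≢0) in there e∈s , c≢0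

ι-supp : ∀ {n} e (c : Chain n) σ → ¬ ι e c σ ≡ 0ℚ → e ∉ σ × ¬ c (σ ∪ ⁅ e ⁆) ≡ 0ℚ
ι-supp {suc n} zero c (outside ∷ s) ≢0 =
  (λ ()) , λ eq → ≢0 (trans (cong (c ¹) (sym (∪-identityʳ s))) eq)
ι-supp zero    c (inside ∷ s)  ≢0 = ⊥-elim (≢0 refl)
ι-supp (suc e) c (outside ∷ s) ≢0 = let e∉s , c≢0 = ι-supp e _ s ≢0 in
  (λ { (there e∈s) → e∉s e∈s }) , c≢0
ι-supp (suc e) c (inside ∷ s)  ≢0 = let e∉s , c≢0 = ι-supp e _ s (neg-≢0 ≢0) in
  (λ { (there e∈s) → e∉s e∈s }) , c≢0

sumS : ∀ {n} → (Subset n → ℚ) → ℚ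
sumS {zero}  g = g []
sumS {suc n} g = sumS (g ⁰) ℚ.+ sumS (g ¹)

sumS-cong : ∀ {n} {g h : Subset n → ℚ} → (∀ s → g s ≡ h s) → sumS g ≡ sumS h
sumS-cong {zero}  g≗h = g≗h []
sumS-cong {suc n} g≗h =
  cong₂ ℚ._+_ (sumS-cong (λ s → g≗h (outside ∷ s))) (sumS-cong (λ s → g≗h (inside ∷ s)))

sumS-0 : ∀ {n} {g : Subset n → ℚ} → (∀ s → g s ≡ 0ℚ) → sumS g ≡ 0ℚ
sumS-0 {zero}  g≗0 = g≗0 []
sumS-0 {suc n} g≗0 = cong₂ ℚ._+_ (sumS-0 (λ s → g≗0 (outside ∷ s))) (sumS-0 (λ s → g≗0 (inside ∷ s)))

sumS-+ : ∀ {n} (g h : Subset n → ℚ) → sumS (λ s → g s ℚ.+ h s) ≡ sumS g ℚ.+ sumS h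
sumS-+ {zero}  g h = refl
sumS-+ {suc n} g h =
  trans (cong₂ ℚ._+_ (sumS-+ (g ⁰) (h ⁰)) (sumS-+ (g ¹) (h ¹))) (interchange (sumS (g ⁰)) _ _ _)

sumS-neg : ∀ {n} (g : Subset n → ℚ) → sumS (λ s → - g s) ≡ - sumS g
sumS-neg {zero}  g = refl
sumS-neg {suc n} g =
  trans (cong₂ ℚ._+_ (sumS-neg (g ⁰)) (sumS-neg (g ¹))) (sym (ℚ.neg-distrib-+ (sumS (g ⁰)) _))

sumS-≢0 : ∀ {n} (g : Subset n → ℚ) → ¬ sumS g ≡ 0ℚ → ∃ λ s → ¬ g s ≡ 0ℚ
sumS-≢0 {zero}  g ≢0 = [] , ≢0
sumS-≢0 {suc n} g = +-≢0 (sumS (g ⁰)) (sumS (g ¹))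
  (λ ≢0 → let s , gs≢0 = sumS-≢0 (g ⁰) ≢0 in _ , gs≢0)
  (λ ≢0 → let s , gs≢0 = sumS-≢0 (g ¹) ≢0 in _ , gs≢0)

bd-sumS : ∀ {m n} (g : Subset m → Chain n) τ →
          bd (λ σ → sumS (λ A → g A σ)) τ ≡ sumS (λ A → bd (g A) τ)
bd-sumS {zero}  g τ = refl
bd-sumS {suc m} g τ =
  trans (bd-+ (λ σ → sumS (λ A → g (outside ∷ A) σ)) (λ σ → sumS (λ A → g (inside ∷ A) σ)) τ)
        (cong₂ ℚ._+_ (bd-sumS (λ A → g (outside ∷ A)) τ) (bd-sumS (λ A → g (inside ∷ A)) τ))

single : ∀ {n} → Subset n → Chain n
single []            []            = 1ℚ
single (outside ∷ A) (outside ∷ σ) = single A σ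
single (inside ∷ A)  (inside ∷ σ)  = single A σ
single (outside ∷ A) (inside ∷ σ)  = 0ℚ
single (inside ∷ A)  (outside ∷ σ) = 0ℚ

single-refl : ∀ {n} (A : Subset n) → single A A ≡ 1ℚ
single-refl []            = refl
single-refl (outside ∷ A) = single-refl A
single-refl (inside ∷ A)  = single-refl A

single-supp : ∀ {n} (A : Subset n) → Supp (_≡ A) (single A)
single-supp []            []            ≢0 = refl
single-supp (outside ∷ A) (outside ∷ σ) ≢0 = cong (outside ∷_) (single-supp A σ ≢0)
single-supp (inside ∷ A)  (inside ∷ σ)  ≢0 = cong (inside ∷_) (single-supp A σ ≢0)
single-supp (outside ∷ A) (inside ∷ σ)  ≢0 = ⊥-elim (≢0 refl)
single-supp (inside ∷ A)  (outside ∷ σ) ≢0 = ⊥-elim (≢0 refl)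

sumS-single : ∀ {n} (c : Chain n) σ → sumS (λ A → c A * single A σ) ≡ c σ
sumS-single c []            = ℚ.*-identityʳ _
sumS-single c (outside ∷ σ) =
  trans (cong₂ ℚ._+_ (sumS-single (c ⁰) σ) (sumS-0 (λ A → ℚ.*-zeroʳ (c (inside ∷ A))))) (ℚ.+-identityʳ _)
sumS-single c (inside ∷ σ)  =
  trans (cong₂ ℚ._+_ (sumS-0 (λ A → ℚ.*-zeroʳ (c (outside ∷ A)))) (sumS-single (c ¹) σ)) (ℚ.+-identityˡ _)

sumS-single-⊥ : ∀ n → sumS {n} (single ⊥) ≡ 1ℚ
sumS-single-⊥ zero    = refl
sumS-single-⊥ (suc n) =
  trans (cong₂ ℚ._+_ (sumS-single-⊥ n) (sumS-0 {n} (λ s → refl))) (ℚ.+-identityʳ _)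

≡0-stable : ∀ {a} → ¬ ¬ a ≡ 0ℚ → a ≡ 0ℚ
≡0-stable {a} = decidable-stable (a ℚ.≟ 0ℚ)

bd-single-⊥ : ∀ {n} (τ : Subset n) → bd (single ⊥) τ ≡ 0ℚ
bd-single-⊥ {n} τ = ≡0-stable λ ≢0 →
  let x , _ , s≢0 = bd-supp (single ⊥) τ ≢0
  in ∉⊥ (subst (x ∈_) (single-supp ⊥ (τ ∪ ⁅ x ⁆) s≢0) (q⊆p∪q τ ⁅ x ⁆ (x∈⁅x⁆ x)))

cobd : ∀ {n} → Chain n → Chain n
cobd g []            = 0ℚ
cobd g (outside ∷ s) = cobd (g ⁰) s
cobd g (inside ∷ s)  = g (outside ∷ s) ℚ.+ - cobd (g ¹) s

cobd-0 : ∀ {n} {g : Chain n} → (∀ s → g s ≡ 0ℚ) → ∀ τ → cobd g τ ≡ 0ℚ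
cobd-0 g≗0 []            = refl
cobd-0 g≗0 (outside ∷ s) = cobd-0 (λ t → g≗0 _) s
cobd-0 g≗0 (inside ∷ s)  = cong₂ (λ a b → a ℚ.+ - b) (g≗0 _) (cobd-0 (λ t → g≗0 _) s)

trace : ∀ {n} (H : Subset n → Chain n) →
        sumS (λ τ → bd (H τ) τ) ≡ sumS (λ τ → cobd (λ τ′ → H τ′ τ) τ)
trace {zero}  H = refl
trace {suc n} H = begin
  sumS (λ s → Hoi s ℚ.+ bd (H (outside ∷ s) ⁰) s) ℚ.+ sumS (λ s → - bd (H (inside ∷ s) ¹) s)
    ≡⟨ cong₂ ℚ._+_ (sumS-+ Hoi _) (sumS-neg (λ s → bd (H (inside ∷ s) ¹) s)) ⟩
  (sumS Hoi ℚ.+ sumS (λ s → bd (H (outside ∷ s) ⁰) s)) ℚ.+ - sumS (λ s → bd (H (inside ∷ s) ¹) s)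
    ≡⟨ cong₂ (λ a b → (sumS Hoi ℚ.+ a) ℚ.+ - b)
         (trace (λ s → H (outside ∷ s) ⁰)) (trace (λ s → H (inside ∷ s) ¹)) ⟩
  (sumS Hoi ℚ.+ sumS Co) ℚ.+ - sumS Ci
    ≡⟨ rearrange (sumS Hoi) (sumS Co) (sumS Ci) ⟩
  sumS Co ℚ.+ (sumS Hoi ℚ.+ - sumS Ci)
    ≡⟨ cong (λ z → sumS Co ℚ.+ (sumS Hoi ℚ.+ z)) (sym (sumS-neg Ci)) ⟩
  sumS Co ℚ.+ (sumS Hoi ℚ.+ sumS (λ s → - Ci s))
    ≡⟨ cong (sumS Co ℚ.+_) (sym (sumS-+ Hoi _)) ⟩
  sumS Co ℚ.+ sumS (λ s → Hoi s ℚ.+ - Ci s) ∎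
  where
  open ≡-Reasoning
  Hoi Co Ci : Subset n → ℚ
  Hoi s = H (outside ∷ s) (inside ∷ s)
  Co s = cobd (λ s′ → H (outside ∷ s′) (outside ∷ s)) s
  Ci s = cobd (λ s′ → H (inside ∷ s′) (inside ∷ s)) s
  rearrange : ∀ a b c → (a ℚ.+ b) ℚ.+ - c ≡ b ℚ.+ (a ℚ.+ - c)
  rearrange = solve-∀ ℚ-ring

-- Cubes

data State : Set where
  out inn free : State

-- The cell c is the cube of all σ with bot c ⊆ σ ⊆ top c.
Cell : ℕ → Set
Cell = Vec State

top bot : ∀ {n} → Cell n → Subset n
top []         = []
top (out ∷ s)  = outside ∷ top s
top (inn ∷ s)  = inside ∷ top s
top (free ∷ s) = inside ∷ top s
bot []         = []
bot (out ∷ s)  = outside ∷ bot s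
bot (inn ∷ s)  = inside ∷ bot s
bot (free ∷ s) = outside ∷ bot s

dim : ∀ {n} → Cell n → ℕ
dim []         = 0
dim (out ∷ s)  = dim s
dim (inn ∷ s)  = dim s
dim (free ∷ s) = suc (dim s)

∇ : ∀ {n} → (Cell n → ℚ) → Cell n → ℚ
∇ F []         = 0ℚ
∇ F (out ∷ s)  = ∇ (λ t → F (out ∷ t)) s
∇ F (inn ∷ s)  = ∇ (λ t → F (inn ∷ t)) s
∇ F (free ∷ s) = F (out ∷ s) ℚ.+ - F (inn ∷ s) ℚ.+ - ∇ (λ t → F (free ∷ t)) s

isVertex : ∀ {n} → Cell n → ℚ
isVertex []         = 1ℚ
isVertex (out ∷ s)  = isVertex s
isVertex (inn ∷ s)  = isVertex s
isVertex (free ∷ s) = 0ℚ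

data _◁_ : ∀ {n} → Cell n → Cell n → Set where
  drop : ∀ {n} {s : Cell n} → (out ∷ s) ◁ (free ∷ s)
  fix  : ∀ {n} {s : Cell n} → (inn ∷ s) ◁ (free ∷ s)
  skip : ∀ {n x} {s t : Cell n} → s ◁ t → (x ∷ s) ◁ (x ∷ t)

◁-dim : ∀ {n} {s t : Cell n} → s ◁ t → dim t ≡ suc (dim s)
◁-dim drop                = refl
◁-dim fix                 = refl
◁-dim (skip {x = out} p)  = ◁-dim p
◁-dim (skip {x = inn} p)  = ◁-dim p
◁-dim (skip {x = free} p) = cong suc (◁-dim p)

◁-top : ∀ {n} {s t : Cell n} → s ◁ t → top s ⊆ top t
◁-top drop (there p)                    = there p
◁-top fix p                             = p
◁-top (skip {x = out} q) (there p)      = there (◁-top q p)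
◁-top (skip {x = inn} q) here           = here
◁-top (skip {x = inn} q) (there p)      = there (◁-top q p)
◁-top (skip {x = free} q) here          = here
◁-top (skip {x = free} q) (there p)     = there (◁-top q p)

◁-bot : ∀ {n} {s t : Cell n} → s ◁ t → bot t ⊆ bot s
◁-bot drop p                            = p
◁-bot fix (there p)                     = there p
◁-bot (skip {x = out} q) (there p)      = there (◁-bot q p)
◁-bot (skip {x = inn} q) here           = here
◁-bot (skip {x = inn} q) (there p)      = there (◁-bot q p)
◁-bot (skip {x = free} q) (there p)     = there (◁-bot q p)

bot⊆top : ∀ {n} (s : Cell n) → bot s ⊆ top s
bot⊆top (out ∷ s)  (there p) = there (bot⊆top s p)
bot⊆top (inn ∷ s)  here      = here
bot⊆top (inn ∷ s)  (there p) = there (bot⊆top s p)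
bot⊆top (free ∷ s) (there p) = there (bot⊆top s p)

dim≤n : ∀ {n} (s : Cell n) → dim s ℕ.≤ n
dim≤n []         = ℕ.z≤n
dim≤n (out ∷ s)  = ℕ.m≤n⇒m≤1+n (dim≤n s)
dim≤n (inn ∷ s)  = ℕ.m≤n⇒m≤1+n (dim≤n s)
dim≤n (free ∷ s) = ℕ.s≤s (dim≤n s)

∇-cong : ∀ {n} {F G : Cell n → ℚ} (c : Cell n) → (∀ c′ → c′ ◁ c → F c′ ≡ G c′) → ∇ F c ≡ ∇ G c
∇-cong []         F≗G = refl
∇-cong (out ∷ s)  F≗G = ∇-cong s (λ t p → F≗G _ (skip p))
∇-cong (inn ∷ s)  F≗G = ∇-cong s (λ t p → F≗G _ (skip p))
∇-cong (free ∷ s) F≗G =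
  cong₂ (λ a b → a ℚ.+ - b) (cong₂ (λ a b → a ℚ.+ - b) (F≗G _ drop) (F≗G _ fix))
        (∇-cong s (λ t p → F≗G _ (skip p)))

∇-0 : ∀ {n} (c : Cell n) → ∇ (λ _ → 0ℚ) c ≡ 0ℚ
∇-0 []         = refl
∇-0 (out ∷ s)  = ∇-0 s
∇-0 (inn ∷ s)  = ∇-0 s
∇-0 (free ∷ s) = cong (λ a → 0ℚ ℚ.+ - 0ℚ ℚ.+ - a) (∇-0 s)

∇-supp : ∀ {n} (F : Cell n → ℚ) c → ¬ ∇ F c ≡ 0ℚ → ∃ λ c′ → c′ ◁ c × ¬ F c′ ≡ 0ℚ
∇-supp F []         ≢0 = ⊥-elim (≢0 refl)
∇-supp F (out ∷ s)  ≢0 = let t , p , q = ∇-supp _ s ≢0 in _ , skip p , q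
∇-supp F (inn ∷ s)  ≢0 = let t , p , q = ∇-supp _ s ≢0 in _ , skip p , q
∇-supp F (free ∷ s) = +-≢0 (F (out ∷ s) ℚ.+ - F (inn ∷ s)) _
  (+-≢0 (F (out ∷ s)) _ (λ ≢0 → _ , drop , ≢0) (λ ≢0 → _ , fix , neg-≢0 ≢0))
  (λ ≢0 → let t , p , q = ∇-supp _ s (neg-≢0 ≢0) in _ , skip p , q)

∇-+ : ∀ {n} (F G : Cell n → ℚ) c → ∇ (λ s → F s ℚ.+ G s) c ≡ ∇ F c ℚ.+ ∇ G c
∇-+ F G []         = refl
∇-+ F G (out ∷ s)  = ∇-+ _ _ s
∇-+ F G (inn ∷ s)  = ∇-+ _ _ s
∇-+ F G (free ∷ s) =
  trans (cong (λ z → F (out ∷ s) ℚ.+ G (out ∷ s) ℚ.+ - (F (inn ∷ s) ℚ.+ G (inn ∷ s)) ℚ.+ - z)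
              (∇-+ (λ t → F (free ∷ t)) (λ t → G (free ∷ t)) s))
        (rearrange (F (out ∷ s)) (G (out ∷ s)) (F (inn ∷ s)) (G (inn ∷ s)) _ _)
  where
  rearrange : ∀ a b c d e f →
              a ℚ.+ b ℚ.+ - (c ℚ.+ d) ℚ.+ - (e ℚ.+ f) ≡ (a ℚ.+ - c ℚ.+ - e) ℚ.+ (b ℚ.+ - d ℚ.+ - f)
  rearrange = solve-∀ ℚ-ring

∇-neg : ∀ {n} (F : Cell n → ℚ) c → ∇ (λ s → - F s) c ≡ - ∇ F c
∇-neg F []         = refl
∇-neg F (out ∷ s)  = ∇-neg _ s
∇-neg F (inn ∷ s)  = ∇-neg _ s
∇-neg F (free ∷ s) =
  trans (cong (λ z → - F (out ∷ s) ℚ.+ - - F (inn ∷ s) ℚ.+ - z) (∇-neg (λ t → F (free ∷ t)) s))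
        (rearrange (F (out ∷ s)) (F (inn ∷ s)) _)
  where
  rearrange : ∀ a b c → - a ℚ.+ - - b ℚ.+ - - c ≡ - (a ℚ.+ - b ℚ.+ - c)
  rearrange = solve-∀ ℚ-ring

∇-∇ : ∀ {n} (F : Cell n → ℚ) c → ∇ (∇ F) c ≡ 0ℚ
∇-∇ F []         = refl
∇-∇ F (out ∷ s)  = ∇-∇ _ s
∇-∇ F (inn ∷ s)  = ∇-∇ _ s
∇-∇ {suc n} F (free ∷ s) = begin
  ∇ o s ℚ.+ - ∇ i s ℚ.+ - ∇ (λ t → o t ℚ.+ - i t ℚ.+ - ∇ f t) s
    ≡⟨ cong (λ z → ∇ o s ℚ.+ - ∇ i s ℚ.+ - z) expand ⟩
  ∇ o s ℚ.+ - ∇ i s ℚ.+ - (∇ o s ℚ.+ - ∇ i s ℚ.+ - 0ℚ)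
    ≡⟨ cancel (∇ o s) (∇ i s) ⟩
  0ℚ ∎
  where
  open ≡-Reasoning
  o i f : Cell n → ℚ
  o t = F (out ∷ t)
  i t = F (inn ∷ t)
  f t = F (free ∷ t)
  expand : ∇ (λ t → o t ℚ.+ - i t ℚ.+ - ∇ f t) s ≡ ∇ o s ℚ.+ - ∇ i s ℚ.+ - 0ℚ
  expand = trans (∇-+ (λ t → o t ℚ.+ - i t) (λ t → - ∇ f t) s)
    (cong₂ ℚ._+_ (trans (∇-+ o _ s) (cong (∇ o s ℚ.+_) (∇-neg i s)))
               (trans (∇-neg (∇ f) s) (cong -_ (∇-∇ f s))))
  cancel : ∀ a b → a ℚ.+ - b ℚ.+ - (a ℚ.+ - b ℚ.+ - 0ℚ) ≡ 0ℚ
  cancel = solve-∀ ℚ-ring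

∇-isVertex : ∀ {n} r (c : Cell n) → ∇ (λ s → isVertex s * r) c ≡ 0ℚ
∇-isVertex r []         = refl
∇-isVertex r (out ∷ s)  = ∇-isVertex r s
∇-isVertex r (inn ∷ s)  = ∇-isVertex r s
∇-isVertex r (free ∷ s) = begin
  isVertex s * r ℚ.+ - (isVertex s * r) ℚ.+ - ∇ (λ _ → 0ℚ * r) s
    ≡⟨ cong₂ (λ a b → a ℚ.+ - b) (ℚ.+-inverseʳ (isVertex s * r))
         (trans (∇-cong {G = λ _ → 0ℚ} s (λ _ _ → ℚ.*-zeroˡ r)) (∇-0 s)) ⟩
  0ℚ ∎
  where open ≡-Reasoning

isVertex-≢0 : ∀ {n} (c : Cell n) → ¬ isVertex c ≡ 0ℚ → dim c ≡ 0
isVertex-≢0 []         ≢0 = refl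
isVertex-≢0 (out ∷ s)  ≢0 = isVertex-≢0 s ≢0
isVertex-≢0 (inn ∷ s)  ≢0 = isVertex-≢0 s ≢0
isVertex-≢0 (free ∷ s) ≢0 = ⊥-elim (≢0 refl)

bd-∇ : ∀ {m n} (f : Cell m → Chain n) c τ →
       bd (λ σ → ∇ (λ s → f s σ) c) τ ≡ ∇ (λ s → bd (f s) τ) c
bd-∇ f []         τ = bd-0 τ
bd-∇ f (out ∷ s)  τ = bd-∇ _ s τ
bd-∇ f (inn ∷ s)  τ = bd-∇ _ s τ
bd-∇ f (free ∷ s) τ = begin
  bd (λ σ → fo σ ℚ.+ - fi σ ℚ.+ - ∇ (λ t → f (free ∷ t) σ) s) τ
    ≡⟨ trans (bd-+ (λ σ → fo σ ℚ.+ - fi σ) _ τ)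
         (cong₂ ℚ._+_ (trans (bd-+ fo _ τ) (cong (bd fo τ ℚ.+_) (bd-neg fi τ)))
                    (trans (bd-neg (λ σ → ∇ (λ t → f (free ∷ t) σ) s) τ)
                           (cong -_ (bd-∇ (λ t → f (free ∷ t)) s τ)))) ⟩
  bd fo τ ℚ.+ - bd fi τ ℚ.+ - ∇ (λ t → bd (f (free ∷ t)) τ) s ∎
  where
  open ≡-Reasoning
  fo = f (out ∷ s)
  fi = f (inn ∷ s)

fullCube : ∀ {n} → Subset n → Cell n
fullCube []            = []
fullCube (outside ∷ s) = out ∷ fullCube s
fullCube (inside ∷ s)  = free ∷ fullCube s

top-fullCube : ∀ {n} (τ : Subset n) → top (fullCube τ) ≡ τ
top-fullCube []            = refl
top-fullCube (outside ∷ s) = cong (outside ∷_) (top-fullCube s)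
top-fullCube (inside ∷ s)  = cong (inside ∷_) (top-fullCube s)

isVertex-fullCube : ∀ {n} (τ : Subset n) → isVertex (fullCube τ) ≡ single ⊥ τ
isVertex-fullCube []            = refl
isVertex-fullCube (outside ∷ s) = isVertex-fullCube s
isVertex-fullCube (inside ∷ s)  = refl

∇-fullCube : ∀ {n} (F : Cell n → ℚ) τ → (∀ c x → x ∈ bot c → x ∈ τ → F c ≡ 0ℚ) →
             ∇ F (fullCube τ) ≡ cobd (λ s → F (fullCube s)) τ
∇-fullCube F []            F0 = refl
∇-fullCube F (outside ∷ s) F0 =
  ∇-fullCube _ s (λ c x p q → F0 (out ∷ c) (suc x) (there p) (there q))
∇-fullCube F (inside ∷ s)  F0 = cong₂ (λ a b → a ℚ.+ - b)
  (trans (cong (λ z → F (out ∷ fullCube s) ℚ.+ - z) (F0 _ zero here here))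
         (ℚ.+-identityʳ (F (out ∷ fullCube s))))
  (∇-fullCube (λ t → F (free ∷ t)) s (λ c x p q → F0 (free ∷ c) (suc x) (there p) (there q)))

module _ {R : Set} where

  K : Set → Set
  K A = (A → R) → R

  pure : ∀ {A : Set} → A → K A
  pure a k = k a

  _>>=_ : ∀ {A B : Set} → K A → (A → K B) → K B
  (m >>= f) k = m (λ a → f a k)

  seqVec : ∀ {A : Set} → (∀ {P : A → Set} → (∀ a → K (P a)) → K (∀ a → P a)) →
           ∀ {n} {P : Vec A n → Set} → (∀ v → K (P v)) → K (∀ v → P v)
  seqVec seqA {zero}  m k = m [] (λ p → k λ { [] → p })
  seqVec seqA {suc n} m k =
    seqA (λ a → seqVec seqA (λ v → m (a ∷ v))) (λ f → k λ { (a ∷ v) → f a v })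

  seqSubset : ∀ {n} {P : Subset n → Set} → (∀ s → K (P s)) → K (∀ s → P s)
  seqSubset = seqVec λ m k →
    m outside (λ p → m inside (λ q → k λ { outside → p ; inside → q }))

  seqCell : ∀ {n} {P : Cell n → Set} → (∀ c → K (P c)) → K (∀ c → P c)
  seqCell = seqVec λ m k →
    m out (λ p → m inn (λ q → m free (λ r → k λ { out → p ; inn → q ; free → r })))

-- Finite sets and matroids

private
  variable
    n : ℕ
    p q : Subset n
    x y : Fin n

x∈p∪⁅y⁆⁻ : ∀ (p : Subset n) y → x ∈ p ∪ ⁅ y ⁆ → x ∈ p ⊎ x ≡ y
x∈p∪⁅y⁆⁻ p y x∈ with x∈p∪q⁻ p ⁅ y ⁆ x∈
... | inj₁ x∈p = inj₁ x∈p
... | inj₂ x∈y = inj₂ (x∈⁅y⁆⇒x≡y y x∈y)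

x∈p∪⁅x⁆ : ∀ (p : Subset n) x → x ∈ p ∪ ⁅ x ⁆
x∈p∪⁅x⁆ p x = q⊆p∪q p ⁅ x ⁆ (x∈⁅x⁆ x)

p∪⁅x⁆⊆ : p ⊆ q → x ∈ q → p ∪ ⁅ x ⁆ ⊆ q
p∪⁅x⁆⊆ {p = p} {x = x} p⊆q x∈q y∈ with x∈p∪⁅y⁆⁻ p x y∈
... | inj₁ y∈p  = p⊆q y∈p
... | inj₂ refl = x∈q

∪-least : ∀ {r : Subset n} → p ⊆ r → q ⊆ r → p ∪ q ⊆ r
∪-least {p = p} {q} p⊆r q⊆r y∈ with x∈p∪q⁻ p q y∈
... | inj₁ y∈p = p⊆r y∈p
... | inj₂ y∈q = q⊆r y∈q

x∉p-x : ∀ (p : Subset n) x → x ∉ p - x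
x∉p-x (outside ∷ p) zero    ()
x∉p-x (inside ∷ p)  zero    ()
x∉p-x (_ ∷ p)       (suc x) (there x∈) = x∉p-x p x x∈

∣p∪⁅x⁆∣ : ∀ (p : Subset n) x → x ∉ p → ∣ p ∪ ⁅ x ⁆ ∣ ≡ suc ∣ p ∣
∣p∪⁅x⁆∣ (outside ∷ p) zero    x∉p = cong (suc ∘ ∣_∣) (∪-identityʳ p)
∣p∪⁅x⁆∣ (inside ∷ p)  zero    x∉p = ⊥-elim (x∉p here)
∣p∪⁅x⁆∣ (outside ∷ p) (suc x) x∉p = ∣p∪⁅x⁆∣ p x (x∉p ∘ there)
∣p∪⁅x⁆∣ (inside ∷ p)  (suc x) x∉p = cong suc (∣p∪⁅x⁆∣ p x (x∉p ∘ there))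

p-x∪⁅x⁆ : x ∈ p → (p - x) ∪ ⁅ x ⁆ ≡ p
p-x∪⁅x⁆ {x = x} {p = p} x∈p = ⊆-antisym (p∪⁅x⁆⊆ (p─q⊆p p ⁅ x ⁆) x∈p) ⊇-part
  where
  ⊇-part : p ⊆ (p - x) ∪ ⁅ x ⁆
  ⊇-part {y} y∈p with y ∈? ⁅ x ⁆
  ... | yes y∈x = q⊆p∪q (p - x) ⁅ x ⁆ y∈x
  ... | no  y∉x = p⊆p∪q ⁅ x ⁆ (x∈p∧x∉q⇒x∈p─q y∈p y∉x)

p∪⁅x⁆-x : x ∉ p → (p ∪ ⁅ x ⁆) - x ≡ p
p∪⁅x⁆-x {x = x} {p = p} x∉p = ⊆-antisym ⊆-part
  (λ y∈p → x∈p∧x≢y⇒x∈p-y (p⊆p∪q ⁅ x ⁆ y∈p) (λ { refl → x∉p y∈p }))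
  where
  ⊆-part : (p ∪ ⁅ x ⁆) - x ⊆ p
  ⊆-part y∈ with x∈p∪⁅y⁆⁻ p x (p─q⊆p (p ∪ ⁅ x ⁆) ⁅ x ⁆ y∈)
  ... | inj₁ y∈p  = y∈p
  ... | inj₂ refl = ⊥-elim (x∉p-x (p ∪ ⁅ x ⁆) x y∈)

∣p-x∣ : x ∈ p → ∣ p ∣ ≡ suc ∣ p - x ∣
∣p-x∣ {x = x} {p = p} x∈p =
  trans (cong ∣_∣ (sym (p-x∪⁅x⁆ x∈p))) (∣p∪⁅x⁆∣ (p - x) x (x∉p-x p x))

∣p-x∣≤ : ∀ {k} → x ∈ p → ∣ p ∣ ≤ suc k → ∣ p - x ∣ ≤ k
∣p-x∣≤ {k = k} x∈p p≤ = s≤s⁻¹ (subst (_≤ suc k) (∣p-x∣ x∈p) p≤)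

⊈⇒∃ : ¬ p ⊆ q → ∃ λ x → x ∈ p × x ∉ q
⊈⇒∃ {p = p} {q} p⊈q with any? (λ x → (x ∈? p) ×-dec ¬? (x ∈? q))
... | yes found = found
... | no  none  = ⊥-elim (p⊈q λ {x} x∈p → decidable-stable (x ∈? q) λ x∉q → none (x , x∈p , x∉q))

∣p∣<∣q∣⇒∃ : ∣ p ∣ < ∣ q ∣ → ∃ λ x → x ∈ q × x ∉ p
∣p∣<∣q∣⇒∃ lt = ⊈⇒∃ λ q⊆p → ℕ.<⇒≱ lt (p⊆q⇒∣p∣≤∣q∣ q⊆p)

∣p∪q∣+∣p∩q∣ : ∀ (p q : Subset n) → ∣ p ∪ q ∣ + ∣ p ∩ q ∣ ≡ ∣ p ∣ + ∣ q ∣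
∣p∪q∣+∣p∩q∣ []            []            = refl
∣p∪q∣+∣p∩q∣ (outside ∷ p) (outside ∷ q) = ∣p∪q∣+∣p∩q∣ p q
∣p∪q∣+∣p∩q∣ (inside ∷ p)  (outside ∷ q) = cong suc (∣p∪q∣+∣p∩q∣ p q)
∣p∪q∣+∣p∩q∣ (outside ∷ p) (inside ∷ q)  =
  trans (cong suc (∣p∪q∣+∣p∩q∣ p q)) (sym (ℕ.+-suc ∣ p ∣ ∣ q ∣))
∣p∪q∣+∣p∩q∣ (inside ∷ p)  (inside ∷ q)  =
  cong suc (trans (ℕ.+-suc _ _) (trans (cong suc (∣p∪q∣+∣p∩q∣ p q)) (sym (ℕ.+-suc ∣ p ∣ ∣ q ∣))))

∣p∪q∣≤∣p∣+∣q∣ : ∀ (p q : Subset n) → ∣ p ∪ q ∣ ≤ ∣ p ∣ + ∣ q ∣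
∣p∪q∣≤∣p∣+∣q∣ p q = ℕ.≤-trans (ℕ.m≤m+n _ ∣ p ∩ q ∣) (ℕ.≤-reflexive (∣p∪q∣+∣p∩q∣ p q))

∣p∪q∣-disjoint : ∀ (p q : Subset n) → Empty (p ∩ q) → ∣ p ∪ q ∣ ≡ ∣ p ∣ + ∣ q ∣
∣p∪q∣-disjoint {n} p q p∩q=∅ = begin
  ∣ p ∪ q ∣              ≡⟨ sym (ℕ.+-identityʳ _) ⟩
  ∣ p ∪ q ∣ + 0
    ≡⟨ cong (∣ p ∪ q ∣ +_) (sym (trans (cong ∣_∣ (Empty-unique p∩q=∅)) (∣⊥∣≡0 n))) ⟩
  ∣ p ∪ q ∣ + ∣ p ∩ q ∣  ≡⟨ ∣p∪q∣+∣p∩q∣ p q ⟩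
  ∣ p ∣ + ∣ q ∣          ∎
  where open ≡-Reasoning

x∈p─q⇒x∉q : ∀ (p q : Subset n) → x ∈ p ─ q → x ∉ q
x∈p─q⇒x∉q (_ ∷ p) (inside ∷ q)  ()          here
x∈p─q⇒x∉q (_ ∷ p) (_ ∷ q)       (there x∈) (there x∈q) = x∈p─q⇒x∉q p q x∈ x∈q

p∩[q─p]-empty : ∀ (p q : Subset n) → Empty (p ∩ (q ─ p))
p∩[q─p]-empty p q (x , x∈) = let x∈p , x∈q─p = x∈p∩q⁻ p (q ─ p) x∈ in x∈p─q⇒x∉q q p x∈q─p x∈p

p∪[q─p] : p ⊆ q → p ∪ (q ─ p) ≡ q
p∪[q─p] {p = p} {q} p⊆q = ⊆-antisym (∪-least p⊆q (p─q⊆p q p)) ⊇-part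
  where
  ⊇-part : q ⊆ p ∪ (q ─ p)
  ⊇-part {x} x∈q with x ∈? p
  ... | yes x∈p = p⊆p∪q (q ─ p) x∈p
  ... | no  x∉p = q⊆p∪q p (q ─ p) (x∈p∧x∉q⇒x∈p─q x∈q x∉p)

∣p∣+∣q─p∣ : p ⊆ q → ∣ p ∣ + ∣ q ─ p ∣ ≡ ∣ q ∣
∣p∣+∣q─p∣ {p = p} {q} p⊆q =
  trans (sym (∣p∪q∣-disjoint p (q ─ p) (p∩[q─p]-empty p q))) (cong ∣_∣ (p∪[q─p] p⊆q))

between : ∀ k → p ⊆ q → ∣ p ∣ ≤ k → k ≤ ∣ q ∣ → ∃ λ r → p ⊆ r × r ⊆ q × ∣ r ∣ ≡ k
between {p = p₀} {q = q} k p⊆q p≤k k≤q = go (k ∸ ∣ p₀ ∣) p₀ p⊆q (ℕ.m∸n+n≡m p≤k)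
  where
  go : ∀ g p → p ⊆ q → g + ∣ p ∣ ≡ k → ∃ λ r → p ⊆ r × r ⊆ q × ∣ r ∣ ≡ k
  go zero    p p⊆q eq = p , (λ x∈ → x∈) , p⊆q , eq
  go (suc g) p p⊆q eq =
    let x , x∈q , x∉p = ∣p∣<∣q∣⇒∃ (ℕ.<-≤-trans (subst (∣ p ∣ <_) eq (s≤s (ℕ.m≤n+m ∣ p ∣ g))) k≤q)
        r , p∪x⊆r , r⊆q , ∣r∣≡k = go g (p ∪ ⁅ x ⁆) (p∪⁅x⁆⊆ p⊆q x∈q)
          (trans (cong (g +_) (∣p∪⁅x⁆∣ p x x∉p)) (trans (ℕ.+-suc g _) eq))
    in r , p∪x⊆r ∘ p⊆p∪q ⁅ x ⁆ , r⊆q , ∣r∣≡k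

∈-allSubsets : ∀ (S : Subset n) → S ∈ₗ allSubsets n
∈-allSubsets []            = Any.here refl
∈-allSubsets (outside ∷ S) = ∈-++⁺ˡ (∈-map⁺ (outside ∷_) (∈-allSubsets S))
∈-allSubsets (inside ∷ S)  = ∈-++⁺ʳ _ (∈-map⁺ (inside ∷_) (∈-allSubsets S))

module _ {A : Set} (f : A → ℕ) where

  ≤-max : ∀ {a} xs → a ∈ₗ xs → f a ≤ List.foldr _⊔_ 0 (List.map f xs)
  ≤-max (x List.∷ xs) (Any.here refl) = ℕ.m≤m⊔n (f x) _
  ≤-max (x List.∷ xs) (Any.there a∈)  = ℕ.≤-trans (≤-max xs a∈) (ℕ.m≤n⊔m (f x) _)

  max-attained : ∀ xs → List.foldr _⊔_ 0 (List.map f xs) ≡ 0 ⊎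
                 ∃ λ a → List.foldr _⊔_ 0 (List.map f xs) ≡ f a
  max-attained List.[] = inj₁ refl
  max-attained (x List.∷ xs) with ℕ.⊔-sel (f x) (List.foldr _⊔_ 0 (List.map f xs))
  ... | inj₁ eq = inj₂ (x , eq)
  ... | inj₂ eq with max-attained xs
  ...   | inj₁ eq₀       = inj₁ (trans eq eq₀)
  ...   | inj₂ (a , eqₐ) = inj₂ (a , trans eq eqₐ)

module Rank {n} (I : Subset n → Bool) (I-matroid : IsMatroid I) where

  I-⊥ : T (I ⊥)
  I-⊥ = proj₁ I-matroid

  I-⊆ : ∀ {A B} → A ⊆ B → T (I B) → T (I A)
  I-⊆ {A} {B} = proj₁ (proj₂ I-matroid) A B

  private
    size : Subset n → Subset n → ℕ
    size W S = if I S ∧ ⌊ S ⊆? W ⌋ then ∣ S ∣ else 0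

    size-≡ : ∀ W S → T (I S) → S ⊆ W → size W S ≡ ∣ S ∣
    size-≡ W S IS S⊆W with I S | S ⊆? W
    ... | true | yes _   = refl
    ... | true | no  S⊈W = ⊥-elim (S⊈W S⊆W)

    size-inv : ∀ W S → size W S ≡ 0 ⊎ (T (I S) × S ⊆ W × size W S ≡ ∣ S ∣)
    size-inv W S with I S | S ⊆? W
    ... | true  | yes S⊆W = inj₂ (_ , S⊆W , refl)
    ... | true  | no  _   = inj₁ refl
    ... | false | _       = inj₁ refl

  ∣S∣≤rank : ∀ W S → T (I S) → S ⊆ W → ∣ S ∣ ≤ rank I W
  ∣S∣≤rank W S IS S⊆W = subst (_≤ rank I W) (size-≡ W S IS S⊆W)
    (≤-max (size W) (allSubsets n) (∈-allSubsets S))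

  rank-attained : ∀ W → ∃ λ S → T (I S) × S ⊆ W × ∣ S ∣ ≡ rank I W
  rank-attained W with max-attained (size W) (allSubsets n)
  ... | inj₁ eq = ⊥ , I-⊥ , ⊥⊆ , trans (∣⊥∣≡0 n) (sym eq)
  ... | inj₂ (S , eq) with size-inv W S
  ...   | inj₁ eq₀               = ⊥ , I-⊥ , ⊥⊆ , trans (∣⊥∣≡0 n) (sym (trans eq eq₀))
  ...   | inj₂ (IS , S⊆W , eqS)  = S , IS , S⊆W , sym (trans eq eqS)

  rank-mono : ∀ {V W} → V ⊆ W → rank I V ≤ rank I W
  rank-mono {V} {W} V⊆W = let S , IS , S⊆V , eq = rank-attained V in
    subst (_≤ rank I W) eq (∣S∣≤rank W S IS (V⊆W ∘ S⊆V))

  rank≤∣∣ : ∀ W → rank I W ≤ ∣ W ∣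
  rank≤∣∣ W = let S , _ , S⊆W , eq = rank-attained W in subst (_≤ ∣ W ∣) eq (p⊆q⇒∣p∣≤∣q∣ S⊆W)

  rank-∪⁅⁆ : ∀ W x → rank I (W ∪ ⁅ x ⁆) ≤ suc (rank I W)
  rank-∪⁅⁆ W x with rank-attained (W ∪ ⁅ x ⁆)
  ... | S , IS , S⊆ , eq with x ∈? S
  ...   | yes x∈S = subst (_≤ suc (rank I W)) (trans (sym (∣p-x∣ x∈S)) eq)
                      (s≤s (∣S∣≤rank W (S - x) (I-⊆ (p─q⊆p S ⁅ x ⁆) IS) S-x⊆W))
    where
    S-x⊆W : S - x ⊆ W
    S-x⊆W y∈ with x∈p∪⁅y⁆⁻ W x (S⊆ (p─q⊆p S ⁅ x ⁆ y∈))
    ... | inj₁ y∈W  = y∈W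
    ... | inj₂ refl = ⊥-elim (x∉p-x S x y∈)
  ...   | no  x∉S = subst (_≤ suc (rank I W)) eq (ℕ.m≤n⇒m≤1+n (∣S∣≤rank W S IS S⊆W))
    where
    S⊆W : S ⊆ W
    S⊆W y∈ with x∈p∪⁅y⁆⁻ W x (S⊆ y∈)
    ... | inj₁ y∈W  = y∈W
    ... | inj₂ refl = ⊥-elim (x∉S y∈)

record Independence {n} (G : Subset n → Set) : Set where
  field
    G?      : ∀ A → Dec (G A)
    G-⊆     : ∀ {A B} → A ⊆ B → G B → G A
    augment : ∀ {A B} → G A → G B → ∣ A ∣ < ∣ B ∣ → ∃ λ x → x ∈ B × x ∉ A × G (A ∪ ⁅ x ⁆)

  extend : ∀ {A B} k → G A → G B → ∣ A ∣ ≤ k → k ≤ ∣ B ∣ →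
           ∃ λ U → A ⊆ U × U ⊆ A ∪ B × ∣ U ∣ ≡ k × G U
  extend {A₀} {B} k GA GB A≤k k≤B = go (k ∸ ∣ A₀ ∣) A₀ (λ x∈ → x∈) (p⊆p∪q B) GA (ℕ.m∸n+n≡m A≤k)
    where
    go : ∀ g A → A₀ ⊆ A → A ⊆ A₀ ∪ B → G A → g + ∣ A ∣ ≡ k →
         ∃ λ U → A₀ ⊆ U × U ⊆ A₀ ∪ B × ∣ U ∣ ≡ k × G U
    go zero    A A₀⊆A A⊆ GA eq = A , A₀⊆A , A⊆ , eq , GA
    go (suc g) A A₀⊆A A⊆ GA eq =
      let x , x∈B , x∉A , GAx = augment GA GB
            (ℕ.<-≤-trans (subst (∣ A ∣ <_) eq (s≤s (ℕ.m≤n+m ∣ A ∣ g))) k≤B)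
      in go g (A ∪ ⁅ x ⁆) (p⊆p∪q ⁅ x ⁆ ∘ A₀⊆A) (p∪⁅x⁆⊆ A⊆ (q⊆p∪q A₀ B x∈B)) GAx
           (trans (cong (g +_) (∣p∪⁅x⁆∣ A x x∉A)) (trans (ℕ.+-suc g _) eq))

module Elongation {n} (I : Subset n → Bool) (I-matroid : IsMatroid I) (j : ℕ) where

  open Rank I I-matroid

  G : Subset n → Set
  G U = ∣ U ∣ ≤ rank I U + j

  G-∪⁅⁆ : ∀ {W x} → x ∉ W → G (W ∪ ⁅ x ⁆) → G W
  G-∪⁅⁆ {W} {x} x∉W GWx = s≤s⁻¹ (subst (_≤ _) (∣p∪⁅x⁆∣ W x x∉W)
    (ℕ.≤-trans GWx (ℕ.+-monoˡ-≤ j (rank-∪⁅⁆ W x))))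

  elongation : Independence G
  elongation = record { G? = λ A → ∣ A ∣ ≤? rank I A + j ; G-⊆ = G-⊆ ; augment = augment }
    where
    G-⊆ : ∀ {A B} → A ⊆ B → G B → G A
    G-⊆ {A} {B} A⊆B GB = go (∣ B ∣ ∸ ∣ A ∣) A A⊆B (ℕ.m∸n+n≡m (p⊆q⇒∣p∣≤∣q∣ A⊆B))
      where
      go : ∀ g A → A ⊆ B → g + ∣ A ∣ ≡ ∣ B ∣ → G A
      go zero    A A⊆B eq with B ⊆? A
      ... | yes B⊆A = subst G (⊆-antisym B⊆A A⊆B) GB
      ... | no  B⊈A = let x , x∈B , x∉A = ⊈⇒∃ B⊈A in
        ⊥-elim (ℕ.<-irrefl eq (p⊂q⇒∣p∣<∣q∣ (A⊆B , x , x∈B , x∉A)))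
      go (suc g) A A⊆B eq =
        let x , x∈B , x∉A = ∣p∣<∣q∣⇒∃ (subst (∣ A ∣ <_) eq (s≤s (ℕ.m≤n+m ∣ A ∣ g)))
        in G-∪⁅⁆ x∉A (go g (A ∪ ⁅ x ⁆) (p∪⁅x⁆⊆ A⊆B x∈B)
             (trans (cong (g +_) (∣p∪⁅x⁆∣ A x x∉A)) (trans (ℕ.+-suc g _) eq)))

    augment : ∀ {A B} → G A → G B → ∣ A ∣ < ∣ B ∣ → ∃ λ x → x ∈ B × x ∉ A × G (A ∪ ⁅ x ⁆)
    augment {A} {B} GA GB A<B with suc ∣ A ∣ ≤? rank I A + j
    ... | yes slack = let x , x∈B , x∉A = ∣p∣<∣q∣⇒∃ A<B in
      x , x∈B , x∉A ,
      ℕ.≤-trans (subst (_≤ _) (sym (∣p∪⁅x⁆∣ A x x∉A)) slack) (ℕ.+-monoˡ-≤ j (rank-mono (p⊆p∪q ⁅ x ⁆)))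
    ... | no  tight with rank-attained A | rank-attained B
    ...   | SA , ISA , SA⊆A , ∣SA∣ | SB , ISB , SB⊆B , ∣SB∣ =
      let x , x∈SB , x∉SA , ISAx = proj₂ (proj₂ I-matroid) SA SB ISA ISB
            (subst₂ _<_ (sym ∣SA∣) (sym ∣SB∣) rA<rB)
          rank-bound = subst (_≤ rank I (A ∪ ⁅ x ⁆)) (trans (∣p∪⁅x⁆∣ SA x x∉SA) (cong suc ∣SA∣))
            (∣S∣≤rank (A ∪ ⁅ x ⁆) (SA ∪ ⁅ x ⁆) ISAx
              (p∪⁅x⁆⊆ (p⊆p∪q ⁅ x ⁆ ∘ SA⊆A) (x∈p∪⁅x⁆ A x)))
          x∉A = λ x∈A → ℕ.1+n≰n (subst (_≤ rank I A) (trans (∣p∪⁅x⁆∣ SA x x∉SA) (cong suc ∣SA∣))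
            (∣S∣≤rank A (SA ∪ ⁅ x ⁆) ISAx (p∪⁅x⁆⊆ SA⊆A x∈A)))
      in x , SB⊆B x∈SB , x∉A ,
         subst (_≤ rank I (A ∪ ⁅ x ⁆) + j) (sym (∣p∪⁅x⁆∣ A x x∉A))
           (ℕ.≤-trans (s≤s GA) (ℕ.+-monoˡ-≤ j rank-bound))
      where
      rA<rB : rank I A < rank I B
      rA<rB = ℕ.+-cancelʳ-< j (rank I A) (rank I B)
        (ℕ.≤-<-trans (s≤s⁻¹ (ℕ.≰⇒> tight)) (ℕ.<-≤-trans A<B GB))

Cycle : Chain n → Set
Cycle z = ∀ τ → bd z τ ≡ 0ℚ

Fills : (Subset n → Set) → Chain n → Set
Fills Q z = ∃ λ b → Supp Q b × (∀ τ → bd b τ ≡ z τ)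

bd-κ-cycle : ∀ v {z : Chain n} → Cycle z → ∀ τ → bd (κ v z) τ ≡ z τ
bd-κ-cycle v {z} ∂z≡0 τ = begin
  bd (κ v z) τ                   ≡⟨ sym (ℚ.+-identityʳ _) ⟩
  bd (κ v z) τ ℚ.+ 0ℚ            ≡⟨ cong (bd (κ v z) τ ℚ.+_) (sym (κ-0 v ∂z≡0 τ)) ⟩
  bd (κ v z) τ ℚ.+ κ v (bd z) τ  ≡⟨ bd-κ v z τ ⟩
  z τ                            ∎
  where open ≡-Reasoning

fill-cone : ∀ {P Q : Subset n → Set} v {z} → Cycle z → Supp P z →
            (∀ {σ} → v ∉ σ → P σ → Q (σ ∪ ⁅ v ⁆)) → Fills Q z
fill-cone {Q = Q} v {z} ∂z≡0 z-supp P⇒Q = κ v z , supp , bd-κ-cycle v ∂z≡0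
  where
  supp : Supp Q (κ v z)
  supp σ ≢0 = let v∈σ , z≢0 = κ-supp v z σ ≢0 in
    subst Q (p-x∪⁅x⁆ v∈σ) (P⇒Q (x∉p-x σ v) (z-supp (σ - v) z≢0))

module MatroidFilling {n} {G : Subset n → Set} (ind : Independence G) where

  open Independence ind

  Link : Subset n → Subset n → ℕ → Subset n → Set
  Link S W s σ = σ ⊆ W × ∣ σ ∣ ≡ s × G (σ ∪ S)

  fill-inside-base : ∀ S W B s {z} → G B → S ⊆ B → B ⊆ S ∪ W → ∣ S ∣ + s < ∣ B ∣ →
                     (∀ σ → Link S W s σ → σ ⊆ B) →
                     Cycle z → Supp (Link S W s) z → Fills (Link S W (suc s)) z
  fill-inside-base S W B s {z} GB S⊆B B⊆ S+s<B Link⇒⊆B ∂z≡0 z-supp =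
    fill-cone {P = Link S W s} {Q = Link S W (suc s)} v {z} ∂z≡0 z-supp
      λ {σ} v∉σ link → (λ {_} → p∪⁅x⁆⊆ (proj₁ link) v∈W) ,
        trans (∣p∪⁅x⁆∣ σ v v∉σ) (cong suc (proj₁ (proj₂ link))) ,
        G-⊆ (∪-least (p∪⁅x⁆⊆ (Link⇒⊆B σ link) v∈B) S⊆B) GB
    where
    pick = ∣p∣<∣q∣⇒∃ {p = S} {B} (ℕ.≤-<-trans (ℕ.m≤m+n ∣ S ∣ s) S+s<B)
    v = proj₁ pick
    v∈B = proj₁ (proj₂ pick)
    v∈W : v ∈ W
    v∈W with x∈p∪q⁻ S W (B⊆ v∈B)
    ... | inj₁ v∈S = ⊥-elim (proj₂ (proj₂ pick) v∈S)
    ... | inj₂ v∈W = v∈W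

  avoid : ∀ {B S W : Subset n} {e} → B ⊆ S ∪ W → e ∉ B → B ⊆ S ∪ (W - e)
  avoid {S = S} {W} {e} B⊆ e∉B y∈B with x∈p∪q⁻ S W (B⊆ y∈B)
  ... | inj₁ y∈S = p⊆p∪q (W - e) y∈S
  ... | inj₂ y∈W = q⊆p∪q S (W - e) (x∈p∧x≢y⇒x∈p-y y∈W (λ { refl → e∉B y∈B }))

  -- Elements e of W outside the independent set B are eliminated one at a time: the part of z through
  -- e is filled in the contraction by e, which moves z off e without changing its class. When W ⊆ B the
  -- complex is a simplex.
  matroid-fill : ∀ N S W B s {z} → ∣ W ∣ ≤ N → G B → S ⊆ B → B ⊆ S ∪ W → ∣ S ∣ + s < ∣ B ∣ →
                 Cycle z → Supp (Link S W s) z → Fills (Link S W (suc s)) z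

  eliminate : ∀ N S W B s {z} e → e ∈ W → e ∉ B → G (S ∪ ⁅ e ⁆) →
              ∣ W - e ∣ ≤ N → G B → S ⊆ B → B ⊆ S ∪ (W - e) → ∣ S ∣ + suc s < ∣ B ∣ →
              Cycle z → Supp (Link S W (suc s)) z → Fills (Link S W (suc (suc s))) z

  matroid-fill N S W B s W≤N GB S⊆B B⊆ S+s<B ∂z≡0 z-supp with W ⊆? B
  ... | yes W⊆B = fill-inside-base S W B s GB S⊆B B⊆ S+s<B (λ _ (σ⊆W , _) y∈σ → W⊆B (σ⊆W y∈σ)) ∂z≡0 z-supp
  matroid-fill N S W B zero W≤N GB S⊆B B⊆ S+s<B ∂z≡0 z-supp | no _ =
    fill-inside-base S W B 0 GB S⊆B B⊆ S+s<B
      (λ _ (_ , ∣σ∣≡0 , _) y∈σ → ⊥-elim (ℕ.0≢1+n (trans (sym ∣σ∣≡0) (∣p-x∣ y∈σ)))) ∂z≡0 z-supp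
  matroid-fill N S W B (suc s) {z} W≤N GB S⊆B B⊆ S+s<B ∂z≡0 z-supp | no W⊈B with ⊈⇒∃ W⊈B
  matroid-fill zero S W B (suc s) {z} W≤N GB S⊆B B⊆ S+s<B ∂z≡0 z-supp | no _ | e , e∈W , e∉B =
    ⊥-elim (ℕ.n≮0 (subst (_≤ 0) (∣p-x∣ e∈W) W≤N))
  matroid-fill (suc N) S W B (suc s) {z} W≤N GB S⊆B B⊆ S+s<B ∂z≡0 z-supp | no _ | e , e∈W , e∉B
    with G? (S ∪ ⁅ e ⁆)
  ... | yes GSe =
    eliminate N S W B s e e∈W e∉B GSe (∣p-x∣≤ e∈W W≤N) GB S⊆B (avoid B⊆ e∉B) S+s<B ∂z≡0 z-supp
  ... | no ¬GSe =
    let b , b-supp , ∂b≡z =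
          matroid-fill N S (W - e) B (suc s) (∣p-x∣≤ e∈W W≤N) GB S⊆B (avoid B⊆ e∉B) S+s<B ∂z≡0 z-supp′
    in b , (λ σ ≢0 → let σ⊆ , rest = b-supp σ ≢0 in p─q⊆p W ⁅ e ⁆ ∘ σ⊆ , rest) , ∂b≡z
    where
    z-supp′ : Supp (Link S (W - e) (suc s)) z
    z-supp′ σ ≢0 with z-supp σ ≢0
    ... | σ⊆W , ∣σ∣ , Gσ =
      (λ y∈σ → x∈p∧x≢y⇒x∈p-y (σ⊆W y∈σ) (λ { refl →
        ¬GSe (G-⊆ (p∪⁅x⁆⊆ (q⊆p∪q σ S) (p⊆p∪q S y∈σ)) Gσ) })) , ∣σ∣ , Gσ

  eliminate N S W B s {z} e e∈W e∉B GSe W-e≤N GB S⊆B B⊆ S+s<B ∂z≡0 z-supp =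
    let b , b-supp , ∂b≡z′ = matroid-fill N S (W - e) B (suc s) W-e≤N GB S⊆B B⊆ S+s<B ∂z′≡0 z′-supp
    in (λ σ → b σ ℚ.+ - κ e a′ σ) ,
       (λ σ → +-≢0 (b σ) _
          (λ ≢0 → let σ⊆ , rest = b-supp σ ≢0 in p─q⊆p W ⁅ e ⁆ ∘ σ⊆ , rest)
          (λ ≢0 → κa′-supp σ (neg-≢0 ≢0))) ,
       (λ τ → trans (bd-+ b _ τ) (trans (cong₂ ℚ._+_ (∂b≡z′ τ) (bd-neg (κ e a′) τ)) (cancel (z τ) _)))
    where
    cancel : ∀ a b → a ℚ.+ b ℚ.+ - b ≡ a
    cancel = solve-∀ ℚ-ring
    e∉S : e ∉ S
    e∉S = e∉B ∘ S⊆B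
    a = ι e z
    ∂a≡0 : Cycle a
    ∂a≡0 τ = trans (bd-ι e z τ) (cong -_ (ι-0 e ∂z≡0 τ))
    restrict : ∀ {σ} → e ∉ σ → σ ⊆ W → σ ⊆ W - e
    restrict e∉σ σ⊆W y∈σ = x∈p∧x≢y⇒x∈p-y (σ⊆W y∈σ) (λ { refl → e∉σ y∈σ })
    swap : ∀ σ → (σ ∪ ⁅ e ⁆) ∪ S ≡ σ ∪ (S ∪ ⁅ e ⁆)
    swap σ = trans (∪-assoc σ ⁅ e ⁆ S) (cong (σ ∪_) (∪-comm ⁅ e ⁆ S))
    a-supp : Supp (Link (S ∪ ⁅ e ⁆) (W - e) s) a
    a-supp σ ≢0 = let e∉σ , z≢0 = ι-supp e z σ ≢0
                      σe⊆W , ∣σe∣ , Gσe = z-supp (σ ∪ ⁅ e ⁆) z≢0 in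
      restrict e∉σ (σe⊆W ∘ p⊆p∪q ⁅ e ⁆) ,
      ℕ.suc-injective (trans (sym (∣p∪⁅x⁆∣ σ e e∉σ)) ∣σe∣) ,
      subst G (swap σ) Gσe
    ∣Se∣ = ∣p∪⁅x⁆∣ S e e∉S
    B′-data = extend ∣ B ∣ GSe GB
      (subst (_≤ ∣ B ∣) (sym ∣Se∣) (ℕ.≤-trans (s≤s (ℕ.m≤m+n ∣ S ∣ (suc s))) S+s<B)) ℕ.≤-refl
    B′ = proj₁ B′-data
    B′⊆ : B′ ⊆ (S ∪ ⁅ e ⁆) ∪ (W - e)
    B′⊆ y∈ with x∈p∪q⁻ (S ∪ ⁅ e ⁆) B (proj₁ (proj₂ (proj₂ B′-data)) y∈)
    ... | inj₁ y∈Se = p⊆p∪q (W - e) y∈Se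
    ... | inj₂ y∈B with x∈p∪q⁻ S (W - e) (B⊆ y∈B)
    ...   | inj₁ y∈S = p⊆p∪q (W - e) (p⊆p∪q ⁅ e ⁆ y∈S)
    ...   | inj₂ y∈W = q⊆p∪q (S ∪ ⁅ e ⁆) (W - e) y∈W
    a-fill = matroid-fill N (S ∪ ⁅ e ⁆) (W - e) B′ s W-e≤N
      (proj₂ (proj₂ (proj₂ (proj₂ B′-data)))) (proj₁ (proj₂ B′-data)) B′⊆
      (subst₂ _<_ (trans (ℕ.+-suc ∣ S ∣ s) (cong (_+ s) (sym ∣Se∣)))
                  (sym (proj₁ (proj₂ (proj₂ (proj₂ B′-data))))) S+s<B)
      ∂a≡0 a-supp
    a′ = proj₁ a-fill
    a′-supp = proj₁ (proj₂ a-fill)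
    ∂a′≡a = proj₂ (proj₂ a-fill)
    κa′-supp : Supp (Link S W (suc (suc s))) (κ e a′)
    κa′-supp σ ≢0 = let e∈σ , a′≢0 = κ-supp e a′ σ ≢0
                        σ-e⊆ , ∣σ-e∣ , Gσ-e = a′-supp (σ - e) a′≢0 in
      subst (_⊆ W) (p-x∪⁅x⁆ e∈σ) (p∪⁅x⁆⊆ (p─q⊆p W ⁅ e ⁆ ∘ σ-e⊆) e∈W) ,
      trans (∣p-x∣ e∈σ) (cong suc ∣σ-e∣) ,
      subst G (trans (sym (swap (σ - e))) (cong (_∪ S) (p-x∪⁅x⁆ e∈σ))) Gσ-e
    z′ : Chain n
    z′ σ = z σ ℚ.+ bd (κ e a′) σ
    ∂z′≡0 : Cycle z′
    ∂z′≡0 τ = trans (bd-+ z _ τ) (cong₂ ℚ._+_ (∂z≡0 τ) (bd-bd (κ e a′) τ))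
    z′≡ : ∀ σ → z′ σ ≡ ι e (κ e z) σ ℚ.+ a′ σ
    z′≡ σ = trans (cong₂ ℚ._+_ (sym (ικ+κι e z σ)) bdκ) (rearrange (ι e (κ e z) σ) (κ e a σ) (a′ σ))
      where
      κ-cong-a : κ e (bd a′) σ ℚ.+ - κ e a σ ≡ 0ℚ
      κ-cong-a = trans (cong (κ e (bd a′) σ ℚ.+_) (sym (κ-neg e a σ)))
        (trans (sym (κ-+ e (bd a′) (λ t → - a t) σ))
               (κ-0 e (λ t → trans (cong (ℚ._+ - a t) (∂a′≡a t)) (ℚ.+-inverseʳ (a t))) σ))
      bdκ : bd (κ e a′) σ ≡ a′ σ ℚ.+ - κ e a σ
      bdκ = begin
        bd (κ e a′) σ
          ≡⟨ insert _ (κ e (bd a′) σ) (κ e a σ) ⟩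
        (bd (κ e a′) σ ℚ.+ κ e (bd a′) σ) ℚ.+ - (κ e (bd a′) σ ℚ.+ - κ e a σ) ℚ.+ - κ e a σ
          ≡⟨ cong₂ (λ u v → u ℚ.+ - v ℚ.+ - κ e a σ) (bd-κ e a′ σ) κ-cong-a ⟩
        a′ σ ℚ.+ - 0ℚ ℚ.+ - κ e a σ  ≡⟨ simplify (a′ σ) _ ⟩
        a′ σ ℚ.+ - κ e a σ           ∎
        where
        open ≡-Reasoning
        insert : ∀ u v w → u ≡ (u ℚ.+ v) ℚ.+ - (v ℚ.+ - w) ℚ.+ - w
        insert = solve-∀ ℚ-ring
        simplify : ∀ u w → u ℚ.+ - 0ℚ ℚ.+ - w ≡ u ℚ.+ - w
        simplify = solve-∀ ℚ-ring
      rearrange : ∀ u v w → (u ℚ.+ v) ℚ.+ (w ℚ.+ - v) ≡ u ℚ.+ w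
      rearrange = solve-∀ ℚ-ring
    z′-avoids : ∀ σ → ¬ z′ σ ≡ 0ℚ → e ∉ σ
    z′-avoids σ ≢0 = +-≢0 (ι e (κ e z) σ) (a′ σ)
      (λ p → proj₁ (ι-supp e (κ e z) σ p))
      (λ p e∈σ → x∉p-x W e (proj₁ (a′-supp σ p) e∈σ))
      (subst (λ u → ¬ u ≡ 0ℚ) (z′≡ σ) ≢0)
    z′-supp : Supp (Link S (W - e) (suc s)) z′
    z′-supp σ ≢0 = let σ⊆W , rest = +-≢0 (z σ) _ (z-supp σ) via-bd ≢0 in
                   restrict (z′-avoids σ ≢0) σ⊆W , rest
      where
      via-bd : ¬ bd (κ e a′) σ ≡ 0ℚ → Link S W (suc s) σ
      via-bd p = let x , x∉σ , q = bd-supp (κ e a′) σ p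
                     σx⊆W , ∣σx∣ , Gσx = κa′-supp (σ ∪ ⁅ x ⁆) q in
        σx⊆W ∘ p⊆p∪q ⁅ x ⁆ ,
        ℕ.suc-injective (trans (sym (∣p∪⁅x⁆∣ σ x x∉σ)) ∣σx∣) ,
        G-⊆ (∪-least (p⊆p∪q S ∘ p⊆p∪q ⁅ x ⁆) (q⊆p∪q (σ ∪ ⁅ x ⁆) S)) Gσx

subset : ∀ {n} {P : Fin n → Set} → Decidable P → Subset n
subset P? = tabulate (does ∘ P?)

∈-subset⁺ : ∀ {n} {P : Fin n → Set} (P? : Decidable P) {x} → P x → x ∈ subset P?
∈-subset⁺ P? {x} Px = lookup⇒[]= x _ (trans (lookup∘tabulate (does ∘ P?) x) (dec-true (P? x) Px))

∈-subset⁻ : ∀ {n} {P : Fin n → Set} (P? : Decidable P) {x} → x ∈ subset P? → P x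
∈-subset⁻ P? {x} x∈ with P? x | trans (sym (lookup∘tabulate (does ∘ P?) x)) ([]=⇒lookup x∈)
... | yes Px | _ = Px

p-x⊆ : ∀ {n} {p : Subset n} {x} → p - x ⊆ p
p-x⊆ {p = p} {x} = p─q⊆p p ⁅ x ⁆

∈-x : ∀ {n} {p : Subset n} {x y} → y ∈ p → ¬ y ≡ x → y ∈ p - x
∈-x = x∈p∧x≢y⇒x∈p-y

∉-∪⁅⁆ : ∀ {n} {p q : Subset n} {x} → p ∪ ⁅ x ⁆ ≡ q → x ∉ p → p ≡ q - x
∉-∪⁅⁆ {x = x} eq x∉p = trans (sym (p∪⁅x⁆-x x∉p)) (cong (_- x) eq)

bd-single-supp : ∀ {n} (A : Subset n) → Supp (λ σ → ∃ λ x → x ∈ A × σ ≡ A - x) (bd (single A))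
bd-single-supp A σ ≢0 =
  let x , x∉σ , s≢0 = bd-supp (single A) σ ≢0
      eq = single-supp A (σ ∪ ⁅ x ⁆) s≢0
  in x , subst (x ∈_) eq (x∈p∪⁅x⁆ σ x) , ∉-∪⁅⁆ eq x∉σ

bd-single-facet : ∀ {n} (A : Subset n) {x} → x ∈ A →
                  bd (single A) (A - x) * bd (single A) (A - x) ≡ 1ℚ
bd-single-facet (inside ∷ A) here = cong (λ a → a * a)
  (trans (cong₂ ℚ._+_ (trans (cong (single A) (p─⊥≡p A)) (single-refl A)) (bd-0 (A ─ ⊥)))
         (ℚ.+-identityʳ 1ℚ))
bd-single-facet (inside ∷ A) {suc x} (there x∈A) =
  trans (neg-square (bd (single A) (A - x))) (bd-single-facet A x∈A)
  where
  neg-square : ∀ a → (- a) * (- a) ≡ a * a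
  neg-square = solve-∀ ℚ-ring
bd-single-facet (outside ∷ A) {suc x} (there x∈A) =
  trans (cong (λ a → a * a) (ℚ.+-identityˡ (bd (single A) (A - x)))) (bd-single-facet A x∈A)

top-cycle : ∀ {n} (E : Subset n) {e} → e ∈ E → (c : Chain n) → Cycle c →
            Supp (λ σ → σ ⊆ E × suc ∣ σ ∣ ≡ ∣ E ∣) c →
            ∃ λ μ → ∀ σ → c σ ≡ μ * bd (single E) σ
top-cycle E {e} e∈E c ∂c≡0 c-supp = μ , λ σ → begin
  c σ                          ≡⟨ sym (bd-κ-cycle e ∂c≡0 σ) ⟩
  bd (κ e c) σ                 ≡⟨ bd-cong κc≡ σ ⟩
  bd (λ τ → μ * single E τ) σ  ≡⟨ bd-* μ (single E) σ ⟩
  μ * bd (single E) σ          ∎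
  where
  open ≡-Reasoning
  μ = κ e c E
  onlyE : ∀ σ → ¬ κ e c σ ≡ 0ℚ → σ ≡ E
  onlyE σ ≢0 with κ-supp e c σ ≢0
  ... | e∈σ , c≢0 with c-supp (σ - e) c≢0 | E ⊆? σ
  ...   | σ-e⊆E , size | yes E⊆σ = ⊆-antisym (subst (_⊆ E) (p-x∪⁅x⁆ e∈σ) (p∪⁅x⁆⊆ σ-e⊆E e∈E)) E⊆σ
  ...   | σ-e⊆E , size | no  E⊈σ = let x , x∈E , x∉σ = ⊈⇒∃ E⊈σ in
    ⊥-elim (ℕ.<-irrefl (trans (∣p-x∣ e∈σ) size)
      (p⊂q⇒∣p∣<∣q∣ (subst (_⊆ E) (p-x∪⁅x⁆ e∈σ) (p∪⁅x⁆⊆ σ-e⊆E e∈E) , x , x∈E , x∉σ)))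
  κc≡ : ∀ σ → κ e c σ ≡ μ * single E σ
  κc≡ σ with κ e c σ ℚ.≟ 0ℚ
  ... | no ≢0 with onlyE σ ≢0
  ...   | refl = sym (trans (cong (μ *_) (single-refl E)) (ℚ.*-identityʳ μ))
  κc≡ σ | yes ≡0 with single E σ ℚ.≟ 0ℚ
  ... | yes s≡0 = trans ≡0 (sym (trans (cong (μ *_) s≡0) (ℚ.*-zeroʳ μ)))
  ... | no s≢0 with single-supp E σ s≢0
  ...   | refl = sym (trans (cong (μ *_) (single-refl E)) (ℚ.*-identityʳ μ))

single-idem : ∀ {n} (A σ : Subset n) → single A σ * single A σ ≡ single A σ
single-idem []            []            = refl
single-idem (outside ∷ A) (outside ∷ σ) = single-idem A σ
single-idem (inside ∷ A)  (inside ∷ σ)  = single-idem A σ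
single-idem (outside ∷ A) (inside ∷ σ)  = refl
single-idem (inside ∷ A)  (outside ∷ σ) = refl

*-≢0ˡ : ∀ a b → ¬ a * b ≡ 0ℚ → ¬ a ≡ 0ℚ
*-≢0ˡ a b ab≢0 a≡0 = ab≢0 (trans (cong (_* b) a≡0) (ℚ.*-zeroˡ b))

*-≢0ʳ : ∀ a b → ¬ a * b ≡ 0ℚ → ¬ b ≡ 0ℚ
*-≢0ʳ a b ab≢0 b≡0 = ab≢0 (trans (cong (a *_) b≡0) (ℚ.*-zeroʳ a))

-- The chain map on cubes

module Core
  {R : Set} (d m k n : ℕ) (1≤m : 1 ≤ m) (m≤k : m ≤ k) (k≤d+m : k ≤ d + m) (d+m≤n : d + m ≤ n)
  (I : Subset n → Bool) (I-matroid : IsMatroid I) (k≤r : k ≤ rank I ⊤)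
  (Y : Subset n → Set) (Y? : Decidable Y) (Y-⊆ : ∀ σ τ → σ ⊆ τ → Y τ → Y σ)
  (leray : ∀ U i → d ≤ i → (c : Chain n) → IsChain Y U i c → Cycle c →
           K {R} (∃ λ (b : Chain n) → IsChain Y U (suc i) b × (∀ τ → bd b τ ≡ c τ)))
  (hyp : ∀ A B → Empty (A ∩ B) → ∣ A ∣ ≡ suc d → ∣ B ∣ ≡ m ∸ 1 → k ≤ rank I (A ∪ B) →
         Y A ⊎ ∃ λ v → v ∈ B × (∀ σ → σ ⊂ A → Y (σ ∪ ⁅ v ⁆)))
  (large : ∀ τ → Y τ → k ≤ rank I (∁ τ))
  where

  -- With this j, a set U of size d + m satisfies k ≤ ρ(U) iff it is independent in the j-fold elongation.
  j : ℕ
  j = d + m ∸ k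

  k+j : k + j ≡ d + m
  k+j = ℕ.m+[n∸m]≡n k≤d+m

  open Rank I I-matroid
  open Elongation I I-matroid j
  open Independence elongation
  open MatroidFilling elongation

  G-⊥ : G ⊥
  G-⊥ = subst (_≤ rank I ⊥ + j) (sym (∣⊥∣≡0 n)) z≤n

  G-size : ∀ {W} → k ≤ rank I W → ∣ W ∣ ≤ d + m → G W
  G-size k≤ρ W≤ = ℕ.≤-trans W≤ (ℕ.≤-trans (ℕ.≤-reflexive (sym k+j)) (ℕ.+-monoˡ-≤ j k≤ρ))

  good-base : ∀ {W} → k ≤ rank I W → d + m ≤ ∣ W ∣ → ∃ λ B → B ⊆ W × ∣ B ∣ ≡ d + m × G B
  good-base {W} k≤ρ W≥ =
    let S , IS , S⊆W , ∣S∣ = rank-attained W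
        S′ , _ , S′⊆S , ∣S′∣ = between k ⊥⊆ (subst (_≤ k) (sym (∣⊥∣≡0 n)) z≤n)
                                 (subst (k ≤_) (sym ∣S∣) k≤ρ)
        B , S′⊆B , B⊆W , ∣B∣ = between (d + m) (S⊆W ∘ S′⊆S) (subst (_≤ d + m) (sym ∣S′∣) k≤d+m) W≥
    in B , B⊆W , ∣B∣ ,
       G-size (subst (_≤ rank I B) ∣S′∣ (∣S∣≤rank B S′ (I-⊆ S′⊆S IS) S′⊆B)) (ℕ.≤-reflexive ∣B∣)

  good-superset : ∀ {A W} → k ≤ rank I W → d + m ≤ ∣ W ∣ → A ⊆ W → G A → ∣ A ∣ ≤ d + m →
                  ∃ λ U → A ⊆ U × U ⊆ W × ∣ U ∣ ≡ d + m × k ≤ rank I U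
  good-superset {A} {W} k≤ρ W≥ A⊆W GA A≤ =
    let B , B⊆W , ∣B∣ , GB = good-base k≤ρ W≥
        U , A⊆U , U⊆ , ∣U∣ , GU = extend (d + m) GA GB A≤ (ℕ.≤-reflexive (sym ∣B∣))
    in U , A⊆U , ∪-least A⊆W B⊆W ∘ U⊆ , ∣U∣ ,
       ℕ.+-cancelʳ-≤ j k (rank I U) (subst (_≤ rank I U + j) (trans ∣U∣ (sym k+j)) GU)

  hyp-on : ∀ {A U} → A ⊆ U → ∣ A ∣ ≡ suc d → ∣ U ∣ ≡ d + m → k ≤ rank I U →
           Y A ⊎ ∃ λ v → v ∈ U × v ∉ A × (∀ σ → σ ⊂ A → Y (σ ∪ ⁅ v ⁆))
  hyp-on {A} {U} A⊆U ∣A∣ ∣U∣ k≤ρ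
    with hyp A (U ─ A) (p∩[q─p]-empty A U) ∣A∣ size (subst (λ V → k ≤ rank I V) (sym (p∪[q─p] A⊆U)) k≤ρ)
    where
    size : ∣ U ─ A ∣ ≡ m ∸ 1
    size = ℕ.+-cancelˡ-≡ d _ _ eq
      where
      eq : d + ∣ U ─ A ∣ ≡ d + (m ∸ 1)
      eq = ℕ.suc-injective (begin
        suc (d + ∣ U ─ A ∣)  ≡⟨ cong (_+ ∣ U ─ A ∣) (sym ∣A∣) ⟩
        ∣ A ∣ + ∣ U ─ A ∣    ≡⟨ ∣p∣+∣q─p∣ A⊆U ⟩
        ∣ U ∣                ≡⟨ ∣U∣ ⟩
        d + m                ≡⟨ cong (d +_) (sym (ℕ.m+[n∸m]≡n 1≤m)) ⟩
        d + suc (m ∸ 1)      ≡⟨ ℕ.+-suc d _ ⟩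
        suc (d + (m ∸ 1))    ∎)
        where open ≡-Reasoning
  ... | inj₁ YA             = inj₁ YA
  ... | inj₂ (v , v∈ , v-ok) = inj₂ (v , p─q⊆p U A v∈ , x∈p─q⇒x∉q U A v∈ , v-ok)

  d<d+m : suc d ≤ d + m
  d<d+m = subst (_≤ d + m) (ℕ.+-comm d 1) (ℕ.+-monoʳ-≤ d 1≤m)

  G-small : ∀ {σ} → G σ → ∣ σ ∣ ≤ d → Y σ
  G-small {σ} Gσ σ≤d =
    let U , σ⊆U , _ , ∣U∣ , k≤ρ = good-superset k≤r (subst (d + m ≤_) (sym (∣⊤∣≡n n)) d+m≤n) ⊆⊤ Gσ
          (ℕ.≤-trans σ≤d (ℕ.m≤m+n d m))
        A , σ⊆A , A⊆U , ∣A∣ = between (suc d) σ⊆U (ℕ.m≤n⇒m≤1+n σ≤d)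
          (ℕ.≤-trans d<d+m (ℕ.≤-reflexive (sym ∣U∣)))
        σ⊂A = (λ {_} → σ⊆A) , ∣p∣<∣q∣⇒∃ (subst (∣ σ ∣ <_) (sym ∣A∣) (s≤s σ≤d))
    in [ Y-⊆ σ A σ⊆A , (λ (v , _ , _ , v-ok) → Y-⊆ σ (σ ∪ ⁅ v ⁆) (p⊆p∪q ⁅ v ⁆) (v-ok σ σ⊂A)) ]′
         (hyp-on A⊆U ∣A∣ ∣U∣ k≤ρ)

  Y-⊥ : Y ⊥
  Y-⊥ = G-small G-⊥ (subst (_≤ d) (sym (∣⊥∣≡0 n)) z≤n)

  ConeInY : Subset n → Fin n → Set
  ConeInY A v = ∀ a → a ∈ A → Y ((A - a) ∪ ⁅ v ⁆)

  ConeInY? : ∀ A v → Dec (ConeInY A v)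
  ConeInY? A v = all? λ a → (a ∈? A) →-dec Y? ((A - a) ∪ ⁅ v ⁆)

  -- Either alternative exhibits a filling of the sphere ∂A inside Y[W].
  SphereFilled : Subset n → Subset n → Set
  SphereFilled W A = Y A ⊎ ∃ λ v → v ∈ W × v ∉ A × ConeInY A v

  hyp⇒cone : ∀ {A v} → (∀ σ → σ ⊂ A → Y (σ ∪ ⁅ v ⁆)) → ConeInY A v
  hyp⇒cone v-ok a a∈A = v-ok _ (x∈p⇒p-x⊂p a∈A)

  YFace : Subset n → ℕ → Subset n → Set
  YFace W s σ = Y σ × σ ⊆ W × ∣ σ ∣ ≡ s

  fill-sphere : ∀ {A W} → A ⊆ W → ∣ A ∣ ≡ suc d → SphereFilled W A →
                Fills (YFace W (suc d)) (bd (single A))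
  fill-sphere {A} {W} A⊆W ∣A∣ (inj₁ YA) = single A , supp , λ _ → refl
    where
    supp : Supp (YFace W (suc d)) (single A)
    supp σ ≢0 with single-supp A σ ≢0
    ... | refl = YA , (λ {_} → A⊆W) , ∣A∣
  fill-sphere {A} {W} A⊆W ∣A∣ (inj₂ (v , v∈W , v∉A , cone)) =
    fill-cone {P = λ σ → ∃ λ x → x ∈ A × σ ≡ A - x} {Q = YFace W (suc d)}
      v {bd (single A)} (bd-bd (single A)) (bd-single-supp A)
      λ { v∉σ (x , x∈A , refl) → cone x x∈A , (λ {_} → p∪⁅x⁆⊆ (A⊆W ∘ p-x⊆) v∈W) ,
          trans (∣p∪⁅x⁆∣ (A - x) v v∉σ) (trans (sym (∣p-x∣ x∈A)) ∣A∣) }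

  -- When ∂A * ∂T₀ lies in Y, filling this sphere forces every facet (A - a) ∪ T₀ into Y,
  -- since the other facets of A ∪ T₀ contain A, which is not in Y.
  sphere-step : ∀ {A T₀ N} → ∣ A ∣ ≡ suc d → ¬ Y A → Empty (A ∩ T₀) → ∣ T₀ ∣ ≡ suc (suc N) →
                (∀ t → t ∈ T₀ → ∀ a → a ∈ A → Y ((A - a) ∪ (T₀ - t))) →
                K {R} (∀ a → a ∈ A → Y ((A - a) ∪ T₀))
  sphere-step {A} {T₀} {N} ∣A∣ ¬YA A∩T₀ ∣T₀∣ IH =
    leray E (d + N) (ℕ.m≤m+n d N) z z-chain (bd-bd w) >>= λ (b , b-supp , ∂b≡z) →
    pure (conclude b b-supp ∂b≡z)
    where
    E = A ∪ T₀
    ∣E∣ : ∣ E ∣ ≡ suc (suc (suc (d + N)))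
    ∣E∣ = begin
      ∣ E ∣                    ≡⟨ ∣p∪q∣-disjoint A T₀ A∩T₀ ⟩
      ∣ A ∣ + ∣ T₀ ∣           ≡⟨ cong₂ _+_ ∣A∣ ∣T₀∣ ⟩
      suc d + suc (suc N)      ≡⟨ cong suc (trans (ℕ.+-suc d (suc N)) (cong suc (ℕ.+-suc d N))) ⟩
      suc (suc (suc (d + N))) ∎
      where open ≡-Reasoning
    w : Chain n
    w σ = if does (A ⊆? σ) then bd (single E) σ else 0ℚ
    w-in : ∀ {σ} → A ⊆ σ → w σ ≡ bd (single E) σ
    w-in {σ} A⊆σ rewrite dec-true (A ⊆? σ) A⊆σ = refl
    w-supp : ∀ σ → ¬ w σ ≡ 0ℚ → A ⊆ σ × ∃ λ t → t ∈ T₀ × σ ≡ E - t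
    w-supp σ ≢0 with A ⊆? σ
    ... | no  _   = ⊥-elim (≢0 refl)
    ... | yes A⊆σ with bd-single-supp E σ ≢0
    ...   | t , t∈E , refl with x∈p∪q⁻ A T₀ t∈E
    ...     | inj₁ t∈A = ⊥-elim (x∉p-x E t (A⊆σ t∈A))
    ...     | inj₂ t∈T = (λ {_} → A⊆σ) , t , t∈T , refl
    z : Chain n
    z = bd w
    z-avoids : ∀ σ → A ⊆ σ → z σ ≡ 0ℚ
    z-avoids σ A⊆σ = ≡0-stable λ ≢0 →
      let x , _ , ≢0′ = bd-supp (λ τ → bd (single E) τ ℚ.+ - w τ) σ (λ eq → ≢0 (begin
            z σ                                       ≡⟨ sym (double-neg (z σ)) ⟩
            - (0ℚ ℚ.+ - z σ)
              ≡⟨ cong (λ u → - (u ℚ.+ - z σ)) (sym (bd-bd (single E) σ)) ⟩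
            - (bd (bd (single E)) σ ℚ.+ - z σ)
              ≡⟨ cong (λ u → - (bd (bd (single E)) σ ℚ.+ u)) (sym (bd-neg w σ)) ⟩
            - (bd (bd (single E)) σ ℚ.+ bd (λ τ → - w τ) σ)
              ≡⟨ cong -_ (sym (bd-+ (bd (single E)) (λ τ → - w τ) σ)) ⟩
            - bd (λ τ → bd (single E) τ ℚ.+ - w τ) σ  ≡⟨ cong -_ eq ⟩
            0ℚ                                        ∎))
      in ≢0′ (trans (cong (λ u → bd (single E) (σ ∪ ⁅ x ⁆) ℚ.+ - u) (w-in (p⊆p∪q ⁅ x ⁆ ∘ A⊆σ)))
                    (ℚ.+-inverseʳ (bd (single E) (σ ∪ ⁅ x ⁆))))
      where
      open ≡-Reasoning
      double-neg : ∀ u → - (0ℚ ℚ.+ - u) ≡ u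
      double-neg = solve-∀ ℚ-ring
    z-chain : IsChain Y E (d + N) z
    z-chain σ ≢0 with bd-supp w σ ≢0
    ... | x , x∉σ , w≢0 with w-supp (σ ∪ ⁅ x ⁆) w≢0
    ...   | A⊆ , t , t∈T₀ , eq with x ∈? A
    ...     | no  x∉A = ⊥-elim (≢0 (z-avoids σ λ y∈A → A⊆σ y∈A))
      where
      A⊆σ : A ⊆ σ
      A⊆σ y∈A with x∈p∪⁅y⁆⁻ σ x (A⊆ y∈A)
      ... | inj₁ y∈σ  = y∈σ
      ... | inj₂ refl = ⊥-elim (x∉A y∈A)
    ...     | yes x∈A = Y-⊆ σ _ σ⊆ (IH t t∈T₀ x x∈A) , (λ {_} → p-x⊆ ∘ σ⊆E-t) ,
      ℕ.suc-injective (ℕ.suc-injective (begin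
        suc (suc ∣ σ ∣)    ≡⟨ cong suc (sym (∣p∪⁅x⁆∣ σ x x∉σ)) ⟩
        suc ∣ σ ∪ ⁅ x ⁆ ∣  ≡⟨ cong (suc ∘ ∣_∣) eq ⟩
        suc ∣ E - t ∣      ≡⟨ sym (∣p-x∣ (q⊆p∪q A T₀ t∈T₀)) ⟩
        ∣ E ∣              ≡⟨ ∣E∣ ⟩
        _                  ∎))
      where
      open ≡-Reasoning
      σ⊆E-t : σ ⊆ E - t
      σ⊆E-t y∈σ = subst (_ ∈_) eq (p⊆p∪q ⁅ x ⁆ y∈σ)
      σ⊆ : σ ⊆ (A - x) ∪ (T₀ - t)
      σ⊆ y∈σ with x∈p∪q⁻ A T₀ (p-x⊆ (σ⊆E-t y∈σ))
      ... | inj₁ y∈A = p⊆p∪q (T₀ - t) (∈-x y∈A λ { refl → x∉σ y∈σ })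
      ... | inj₂ y∈T = q⊆p∪q (A - x) (T₀ - t) (∈-x y∈T λ { refl → x∉p-x E t (σ⊆E-t y∈σ) })
    conclude : ∀ b → IsChain Y E (suc (d + N)) b → (∀ τ → bd b τ ≡ z τ) →
               ∀ a → a ∈ A → Y ((A - a) ∪ T₀)
    conclude b b-supp ∂b≡z a a∈A =
      Y-⊆ _ (E - a) (∪-least (λ y∈ → ∈-x (p⊆p∪q T₀ (p-x⊆ y∈)) (λ { refl → x∉p-x A a y∈ }))
                             (λ y∈ → ∈-x (q⊆p∪q A T₀ y∈) (λ { refl → A∩T₀ (a , x∈p∩q⁺ (a∈A , y∈)) })))
          (proj₁ (b-supp (E - a) b≢0))
      where
      a∈E : a ∈ E
      a∈E = p⊆p∪q T₀ a∈A
      T₀≢∅ = ∣p∣<∣q∣⇒∃ {p = ⊥} {T₀} (subst₂ _<_ (sym (∣⊥∣≡0 n)) (sym ∣T₀∣) (s≤s z≤n))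
      t = proj₁ T₀≢∅
      t∈T₀ = proj₁ (proj₂ T₀≢∅)
      t∈E : t ∈ E
      t∈E = q⊆p∪q A T₀ t∈T₀
      A⊆E-t : A ⊆ E - t
      A⊆E-t y∈A = ∈-x (p⊆p∪q T₀ y∈A) (λ { refl → A∩T₀ (t , x∈p∩q⁺ (y∈A , t∈T₀)) })
      c : Chain n
      c σ = w σ ℚ.+ - b σ
      ∂c≡0 : Cycle c
      ∂c≡0 τ = trans (bd-+ w _ τ)
        (trans (cong (z τ ℚ.+_) (trans (bd-neg b τ) (cong -_ (∂b≡z τ)))) (ℚ.+-inverseʳ (z τ)))
      c-supp : Supp (λ σ → σ ⊆ E × suc ∣ σ ∣ ≡ ∣ E ∣) c
      c-supp σ = +-≢0 (w σ) (- b σ) from-w from-b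
        where
        from-w : ¬ w σ ≡ 0ℚ → σ ⊆ E × suc ∣ σ ∣ ≡ ∣ E ∣
        from-w ≢0 with w-supp σ ≢0
        ... | _ , s , s∈T₀ , refl = (λ {_} → p-x⊆) , sym (∣p-x∣ (q⊆p∪q A T₀ s∈T₀))
        from-b : ¬ - b σ ≡ 0ℚ → σ ⊆ E × suc ∣ σ ∣ ≡ ∣ E ∣
        from-b ≢0 = let _ , σ⊆E , ∣σ∣ = b-supp σ (neg-≢0 ≢0) in σ⊆E , trans (cong suc ∣σ∣) (sym ∣E∣)
      multiple = top-cycle E a∈E c ∂c≡0 c-supp
      μ = proj₁ multiple
      u u′ : ℚ
      u = bd (single E) (E - t)
      u′ = bd (single E) (E - a)
      b-t : b (E - t) ≡ 0ℚ
      b-t = ≡0-stable λ ≢0 → ¬YA (Y-⊆ A (E - t) A⊆E-t (proj₁ (b-supp (E - t) ≢0)))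
      w-a : w (E - a) ≡ 0ℚ
      w-a = ≡0-stable λ ≢0 → x∉p-x E a (proj₁ (w-supp (E - a) ≢0) a∈A)
      b≢0 : ¬ b (E - a) ≡ 0ℚ
      b≢0 b≡0 = 1≢0 (begin
        1ℚ      ≡⟨ sym (bd-single-facet E t∈E) ⟩
        u * u   ≡⟨ cong (_* u) u≡0 ⟩
        0ℚ * u  ≡⟨ ℚ.*-zeroˡ u ⟩
        0ℚ      ∎)
        where
        open ≡-Reasoning
        1≢0 : ¬ 1ℚ ≡ 0ℚ
        1≢0 ()
        μ≡0 : μ ≡ 0ℚ
        μ≡0 = begin
          μ               ≡⟨ sym (ℚ.*-identityʳ μ) ⟩
          μ * 1ℚ          ≡⟨ cong (μ *_) (sym (bd-single-facet E a∈E)) ⟩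
          μ * (u′ * u′)   ≡⟨ sym (ℚ.*-assoc μ u′ u′) ⟩
          μ * u′ * u′     ≡⟨ cong (_* u′) (sym (proj₂ multiple (E - a))) ⟩
          c (E - a) * u′  ≡⟨ cong (_* u′) (cong₂ (λ x y → x ℚ.+ - y) w-a b≡0) ⟩
          0ℚ * u′         ≡⟨ ℚ.*-zeroˡ u′ ⟩
          0ℚ              ∎
        u≡0 : u ≡ 0ℚ
        u≡0 = begin
          u           ≡⟨ sym (ℚ.+-identityʳ u) ⟩
          u ℚ.+ - 0ℚ  ≡⟨ cong₂ (λ x y → x ℚ.+ - y) (sym (w-in A⊆E-t)) (sym b-t) ⟩
          c (E - t)   ≡⟨ proj₂ multiple (E - t) ⟩
          μ * u       ≡⟨ cong (_* u) μ≡0 ⟩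
          0ℚ * u      ≡⟨ ℚ.*-zeroˡ u ⟩
          0ℚ          ∎

  joins-in-Y : ∀ {A T′} → ∣ A ∣ ≡ suc d → ¬ Y A → G A → Empty (A ∩ T′) → (∀ v → v ∈ T′ → ConeInY A v) →
               ∀ N → K {R} (∀ T₀ → ∣ T₀ ∣ ≤ N → T₀ ⊆ T′ → ∀ a → a ∈ A → Y ((A - a) ∪ T₀))
  joins-in-Y {A} {T′} ∣A∣ ¬YA GA A∩T′ cones = joins
    where
    Joins : ℕ → Subset n → Set
    Joins N T₀ = ∣ T₀ ∣ ≤ N → T₀ ⊆ T′ → ∀ a → a ∈ A → Y ((A - a) ∪ T₀)

    empty-join : ∀ T₀ → Joins 0 T₀
    empty-join T₀ T₀≤0 _ a a∈A = Y-⊆ _ (A - a)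
      (∪-least (λ y∈ → y∈) (λ y∈ → ⊥-elim (ℕ.n≮0 (subst (_≤ 0) (∣p-x∣ y∈) T₀≤0))))
      (G-small (G-⊆ p-x⊆ GA) (ℕ.≤-reflexive (ℕ.suc-injective (trans (sym (∣p-x∣ a∈A)) ∣A∣))))

    point-join : ∀ T₀ → ∣ T₀ ∣ ≡ 1 → T₀ ⊆ T′ → ∀ a → a ∈ A → Y ((A - a) ∪ T₀)
    point-join T₀ ∣T₀∣ T₀⊆T′ a a∈A =
      Y-⊆ _ _ (∪-least (p⊆p∪q ⁅ v ⁆) (λ y∈ → q⊆p∪q (A - a) ⁅ v ⁆ (only-v y∈)))
        (cones v (T₀⊆T′ v∈T₀) a a∈A)
      where
      pick = ∣p∣<∣q∣⇒∃ {p = ⊥} {T₀} (subst₂ _<_ (sym (∣⊥∣≡0 n)) (sym ∣T₀∣) (s≤s z≤n))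
      v = proj₁ pick
      v∈T₀ = proj₁ (proj₂ pick)
      only-v : T₀ ⊆ ⁅ v ⁆
      only-v {y} y∈T₀ = decidable-stable (y ∈? ⁅ v ⁆) λ y∉ →
        ℕ.0≢1+n (trans (sym (ℕ.suc-injective (trans (sym (∣p-x∣ v∈T₀)) ∣T₀∣)))
                       (∣p-x∣ (x∈p∧x∉q⇒x∈p─q y∈T₀ y∉)))

    big-join : ∀ N T₀ → (∀ T₁ → Joins N T₁) → ∣ T₀ ∣ ≡ suc N → T₀ ⊆ T′ →
               K {R} (∀ a → a ∈ A → Y ((A - a) ∪ T₀))
    big-join zero    T₀ IH ∣T₀∣ T₀⊆T′ = pure (point-join T₀ ∣T₀∣ T₀⊆T′)
    big-join (suc N) T₀ IH ∣T₀∣ T₀⊆T′ = sphere-step ∣A∣ ¬YA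
      (λ (x , x∈) → let x∈A , x∈T₀ = x∈p∩q⁻ A T₀ x∈ in A∩T′ (x , x∈p∩q⁺ (x∈A , T₀⊆T′ x∈T₀))) ∣T₀∣
      (λ t t∈T₀ → IH (T₀ - t) (ℕ.≤-reflexive (ℕ.suc-injective (trans (sym (∣p-x∣ t∈T₀)) ∣T₀∣)))
                           (T₀⊆T′ ∘ p-x⊆))

    next : ∀ N → (∀ T₁ → Joins N T₁) → ∀ T₀ → K {R} (Joins (suc N) T₀)
    next N IH T₀ with ∣ T₀ ∣ ℕ.≟ suc N | T₀ ⊆? T′
    ... | no ≢    | _          = λ ret → ret λ le → IH T₀ (s≤s⁻¹ (ℕ.≤∧≢⇒< le ≢))
    ... | yes _   | no  T₀⊈T′  = λ ret → ret λ _ T₀⊆T′ → ⊥-elim (T₀⊈T′ T₀⊆T′)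
    ... | yes eq  | yes T₀⊆T′  = λ ret → big-join N T₀ IH eq T₀⊆T′ λ all → ret λ _ _ → all

    joins : ∀ N → K {R} (∀ T₀ → Joins N T₀)
    joins zero    ret = ret empty-join
    joins (suc N) ret = joins N λ IH → seqSubset (next N IH) ret

  unfilled-absurd : ∀ {T A} → ∣ ∁ T ∣ < d + m → k ≤ rank I (∁ T) → A ⊆ ∁ T → ∣ A ∣ ≡ suc d →
                    ¬ SphereFilled (∁ T) A → K {R} Empty.⊥
  unfilled-absurd {T} {A} W< k≤ρ A⊆W ∣A∣ unfilled =
    joins-in-Y ∣A∣ (unfilled ∘ inj₁) (G-⊆ A⊆W (G-size k≤ρ (ℕ.<⇒≤ W<))) A∩T′
      (λ v v∈ → proj₂ (∈-subset⁻ T′? v∈)) ∣ T′ ∣ >>= λ joins →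
    pure (absurd (joins T′ ℕ.≤-refl (λ y∈ → y∈) a a∈A))
    where
    T′? : Decidable λ v → v ∈ T × ConeInY A v
    T′? v = (v ∈? T) ×-dec ConeInY? A v
    W T′ : Subset n
    W = ∁ T
    T′ = subset T′?
    A∩T′ : Empty (A ∩ T′)
    A∩T′ (x , x∈) = let x∈A , x∈T′ = x∈p∩q⁻ A T′ x∈ in
      x∈∁p⇒x∉p (A⊆W x∈A) (proj₁ (∈-subset⁻ T′? x∈T′))
    pick = ∣p∣<∣q∣⇒∃ {p = ⊥} {A} (subst₂ _<_ (sym (∣⊥∣≡0 n)) (sym ∣A∣) (s≤s z≤n))
    a = proj₁ pick
    a∈A = proj₁ (proj₂ pick)
    few : ∣ W ∣ + ∣ T ─ T′ ∣ < d + m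
    few = ℕ.≰⇒> λ many →
      let t = d + m ∸ ∣ W ∣
          T″ , _ , T″⊆ , ∣T″∣ = between t (⊥⊆ {p = T ─ T′}) (subst (_≤ t) (sym (∣⊥∣≡0 n)) z≤n)
            (ℕ.m≤n+o⇒m∸n≤o (d + m) ∣ W ∣ many)
          ∣U∣ = trans (∣p∪q∣-disjoint W T″ (λ (x , x∈) → let x∈W , x∈T″ = x∈p∩q⁻ W T″ x∈ in
                        x∈∁p⇒x∉p x∈W (p─q⊆p T T′ (T″⊆ x∈T″))))
                (trans (cong (∣ W ∣ +_) ∣T″∣) (ℕ.m+[n∸m]≡n (ℕ.<⇒≤ W<)))
      in unfilled ([ inj₁ , (λ (v , v∈U , v∉A , v-ok) →
           [ (λ v∈W → inj₂ (v , v∈W , v∉A , hyp⇒cone v-ok))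
           , (λ v∈T″ → ⊥-elim (x∈p─q⇒x∉q T T′ (T″⊆ v∈T″)
               (∈-subset⁺ T′? (p─q⊆p T T′ (T″⊆ v∈T″) , hyp⇒cone v-ok)))) ]′ (x∈p∪q⁻ W T″ v∈U)) ]′
           (hyp-on (p⊆p∪q T″ ∘ A⊆W) ∣A∣ ∣U∣ (ℕ.≤-trans k≤ρ (rank-mono (p⊆p∪q T″)))))
    absurd : Y ((A - a) ∪ T′) → Empty.⊥
    absurd Yρ = ℕ.<⇒≱ (begin-strict
      rank I (∁ ρ)                              ≤⟨ rank≤∣∣ (∁ ρ) ⟩
      ∣ ∁ ρ ∣                                   ≤⟨ p⊆q⇒∣p∣≤∣q∣ ∁ρ⊆ ⟩
      ∣ (W ─ (A - a)) ∪ (T ─ T′) ∣              ≤⟨ ∣p∪q∣≤∣p∣+∣q∣ (W ─ (A - a)) (T ─ T′) ⟩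
      ∣ W ─ (A - a) ∣ + ∣ T ─ T′ ∣            <⟨ ℕ.+-cancelˡ-< d _ m (subst (_< d + m) count few) ⟩
      m                                         ≤⟨ m≤k ⟩
      k                                         ∎) (large ρ Yρ)
      where
      open ℕ.≤-Reasoning
      ρ = (A - a) ∪ T′
      count : ∣ W ∣ + ∣ T ─ T′ ∣ ≡ d + (∣ W ─ (A - a) ∣ + ∣ T ─ T′ ∣)
      count = trans (cong (_+ ∣ T ─ T′ ∣) (trans (sym (∣p∣+∣q─p∣ {p = A - a} {W} (A⊆W ∘ p-x⊆)))
        (cong (_+ ∣ W ─ (A - a) ∣) (ℕ.suc-injective (trans (sym (∣p-x∣ a∈A)) ∣A∣)))))
        (ℕ.+-assoc d _ _)
      ∁ρ⊆ : ∁ ρ ⊆ (W ─ (A - a)) ∪ (T ─ T′)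
      ∁ρ⊆ {y} y∈ with y ∈? T
      ... | yes y∈T = q⊆p∪q (W ─ (A - a)) (T ─ T′)
        (x∈p∧x∉q⇒x∈p─q y∈T λ y∈T′ → x∈∁p⇒x∉p y∈ (q⊆p∪q (A - a) T′ y∈T′))
      ... | no  y∉T = p⊆p∪q (T ─ T′)
        (x∈p∧x∉q⇒x∈p─q (x∉p⇒x∈∁p y∉T) λ y∈A → x∈∁p⇒x∉p y∈ (p⊆p∪q T′ y∈A))

  sphere-filled? : ∀ W A → Dec (SphereFilled W A)
  sphere-filled? W A = Y? A ⊎-dec any? λ v → (v ∈? W) ×-dec ¬? (v ∈? A) ×-dec ConeInY? A v

  sphere-filled-large : ∀ {W A} → k ≤ rank I W → d + m ≤ ∣ W ∣ → G A → A ⊆ W → ∣ A ∣ ≡ suc d →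
                        SphereFilled W A
  sphere-filled-large {W} {A} k≤ρ W≥ GA A⊆W ∣A∣ =
    from-superset (good-superset k≤ρ W≥ A⊆W GA (subst (_≤ d + m) (sym ∣A∣) d<d+m))
    where
    from-superset : (∃ λ U → A ⊆ U × U ⊆ W × ∣ U ∣ ≡ d + m × k ≤ rank I U) → SphereFilled W A
    from-superset (U , A⊆U , U⊆W , ∣U∣ , k≤ρU) with hyp-on A⊆U ∣A∣ ∣U∣ k≤ρU
    ... | inj₁ YA                     = inj₁ YA
    ... | inj₂ (v , v∈U , v∉A , v-ok) = inj₂ (v , U⊆W v∈U , v∉A , hyp⇒cone v-ok)

  sphere-filled : ∀ {T A} → Y T → G A → A ⊆ ∁ T → ∣ A ∣ ≡ suc d → K {R} (SphereFilled (∁ T) A)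
  sphere-filled {T} {A} YT GA A⊆W ∣A∣ with sphere-filled? (∁ T) A | d + m ≤? ∣ ∁ T ∣
  ... | yes filled  | _      = pure filled
  ... | no unfilled | no  W< = unfilled-absurd (ℕ.≰⇒> W<) (large T YT) A⊆W ∣A∣ unfilled >>= λ ()
  ... | no unfilled | yes W≥ = pure (sphere-filled-large (large T YT) W≥ GA A⊆W ∣A∣)

  GFace : Subset n → ℕ → Subset n → Set
  GFace W s σ = σ ⊆ W × ∣ σ ∣ ≡ s × G σ

  fill-good-small : ∀ {W} s {z} → k ≤ rank I W → ∣ W ∣ ≤ d + m → Cycle z → Supp (GFace W s) z →
                    Fills (GFace W (suc s)) z
  fill-good-small {W} s {z} k≤ρ W≤ ∂z≡0 z-supp =
    fill-cone {P = GFace W s} {Q = GFace W (suc s)} v {z} ∂z≡0 z-supp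
      λ {σ} v∉σ (σ⊆W , ∣σ∣ , _) → (λ {_} → p∪⁅x⁆⊆ σ⊆W v∈W) ,
        trans (∣p∪⁅x⁆∣ σ v v∉σ) (cong suc ∣σ∣) ,
        G-⊆ (p∪⁅x⁆⊆ σ⊆W v∈W) (G-size k≤ρ W≤)
    where
    pick = ∣p∣<∣q∣⇒∃ {p = ⊥} {W} (subst (_< ∣ W ∣) (sym (∣⊥∣≡0 n))
      (ℕ.≤-trans 1≤m (ℕ.≤-trans m≤k (ℕ.≤-trans k≤ρ (rank≤∣∣ W)))))
    v = proj₁ pick
    v∈W = proj₁ (proj₂ pick)

  fill-good-large : ∀ {W} s {z} → k ≤ rank I W → d + m ≤ ∣ W ∣ → s ≤ d → Cycle z → Supp (GFace W s) z →
                    Fills (GFace W (suc s)) z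
  fill-good-large {W} s {z} k≤ρ W≥ s≤d ∂z≡0 z-supp = from-base (good-base k≤ρ W≥)
    where
    from-base : (∃ λ B → B ⊆ W × ∣ B ∣ ≡ d + m × G B) → Fills (GFace W (suc s)) z
    from-base (B , B⊆W , ∣B∣ , GB) = from-link
      (matroid-fill ∣ W ∣ ⊥ W B s ℕ.≤-refl GB ⊥⊆ (q⊆p∪q ⊥ W ∘ B⊆W)
          (subst₂ _<_ (cong (_+ s) (sym (∣⊥∣≡0 n))) (sym ∣B∣) (ℕ.≤-<-trans s≤d d<d+m)) ∂z≡0
          (λ σ ≢0 → let σ⊆W , ∣σ∣ , Gσ = z-supp σ ≢0 in σ⊆W , ∣σ∣ , subst G (sym (∪-identityʳ σ)) Gσ))
      where
      from-link : Fills (Link ⊥ W (suc s)) z → Fills (GFace W (suc s)) z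
      from-link (b , b-supp , ∂b≡z) = b ,
        (λ σ ≢0 → let σ⊆W , ∣σ∣ , Gσ = b-supp σ ≢0 in σ⊆W , ∣σ∣ , subst G (∪-identityʳ σ) Gσ) , ∂b≡z

  fill-good : ∀ {W} s {z} → k ≤ rank I W → s ≤ d → Cycle z → Supp (GFace W s) z →
              Fills (GFace W (suc s)) z
  fill-good {W} s k≤ρ s≤d ∂z≡0 z-supp =
    [ (λ W≥ → fill-good-large s k≤ρ W≥ s≤d ∂z≡0 z-supp)
    , (λ W≤ → fill-good-small s k≤ρ W≤ ∂z≡0 z-supp) ]′ (ℕ.≤-total (d + m) ∣ W ∣)

  fill-spheres : ∀ {W} {P : Subset n → Set} (b : Chain n) →
                 (∀ A → P A → K {R} (Fills (YFace W (suc d)) (bd (single A)))) →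
                 Supp P b → K {R} (Fills (YFace W (suc d)) (bd b))
  fill-spheres {W} {P} b fill b-supp = seqSubset fill-term >>= λ y → pure (total y)
    where
    Term : Subset n → Set
    Term A = ∃ λ (y : Chain n) → Supp (YFace W (suc d)) y × (∀ τ → bd y τ ≡ b A * bd (single A) τ)
    fill-term : ∀ A → K {R} (Term A)
    fill-term A with b A ℚ.≟ 0ℚ
    ... | yes b≡0 = pure ((λ _ → 0ℚ) , (λ _ ≢0 → ⊥-elim (≢0 refl)) ,
                          λ τ → trans (bd-0 τ) (sym (trans (cong (_* bd (single A) τ) b≡0)
                                                           (ℚ.*-zeroˡ (bd (single A) τ)))))
    ... | no  b≢0 = fill A (b-supp A b≢0) >>= λ (y , y-supp , ∂y) →
      pure ((λ σ → b A * y σ) , (λ σ ≢0 → y-supp σ (*-≢0ʳ (b A) (y σ) ≢0)) ,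
            λ τ → trans (bd-* (b A) y τ) (cong (b A *_) (∂y τ)))
    total : (∀ A → Term A) → Fills (YFace W (suc d)) (bd b)
    total y = (λ σ → sumS (λ A → proj₁ (y A) σ)) ,
      (λ σ ≢0 → let A , ≢0′ = sumS-≢0 (λ A → proj₁ (y A) σ) ≢0 in proj₁ (proj₂ (y A)) σ ≢0′) ,
      λ τ → begin
        bd (λ σ → sumS (λ A → proj₁ (y A) σ)) τ     ≡⟨ bd-sumS (λ A → proj₁ (y A)) τ ⟩
        sumS (λ A → bd (proj₁ (y A)) τ)             ≡⟨ sumS-cong (λ A → proj₂ (proj₂ (y A)) τ) ⟩
        sumS (λ A → b A * bd (single A) τ)
          ≡⟨ sumS-cong (λ A → sym (bd-* (b A) (single A) τ)) ⟩
        sumS (λ A → bd (λ σ → b A * single A σ) τ)  ≡⟨ sym (bd-sumS (λ A σ → b A * single A σ) τ) ⟩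
        bd (λ σ → sumS (λ A → b A * single A σ)) τ  ≡⟨ bd-cong (sumS-single b) τ ⟩
        bd b τ                                      ∎
      where open ≡-Reasoning

  Face : Subset n → ℕ → Subset n → Set
  Face T s σ = σ ⊆ ∁ T × ∣ σ ∣ ≡ s × Y σ × (s ≤ d → G σ)

  fill-face : ∀ {T} s {z} → Y T → Cycle z → Supp (Face T s) z → K {R} (Fills (Face T (suc s)) z)
  fill-face {T} s {z} YT ∂z≡0 z-supp with ℕ.<-cmp s d
  ... | tri< s<d _ _ = pure (from-good (fill-good s (large T YT) (ℕ.<⇒≤ s<d) ∂z≡0
          λ σ ≢0 → let σ⊆ , ∣σ∣ , _ , Gσ = z-supp σ ≢0 in σ⊆ , ∣σ∣ , Gσ (ℕ.<⇒≤ s<d)))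
    where
    from-good : Fills (GFace (∁ T) (suc s)) z → Fills (Face T (suc s)) z
    from-good (b , b-supp , ∂b≡z) = b , supp , ∂b≡z
      where
      supp : Supp (Face T (suc s)) b
      supp σ ≢0 = let σ⊆ , ∣σ∣ , Gσ = b-supp σ ≢0 in
        σ⊆ , ∣σ∣ , G-small Gσ (subst (_≤ d) (sym ∣σ∣) s<d) , λ _ → Gσ
  ... | tri≈ _ refl _ = from-good (fill-good s (large T YT) ℕ.≤-refl ∂z≡0
          λ σ ≢0 → let σ⊆ , ∣σ∣ , _ , Gσ = z-supp σ ≢0 in σ⊆ , ∣σ∣ , Gσ ℕ.≤-refl)
    where
    from-good : Fills (GFace (∁ T) (suc d)) z → K {R} (Fills (Face T (suc d)) z)
    from-good (b , b-supp , ∂b≡z) =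
      fill-spheres b (λ A (A⊆ , ∣A∣ , GA) → sphere-filled YT GA A⊆ ∣A∣ >>= λ filled →
                                            pure (fill-sphere A⊆ ∣A∣ filled)) b-supp
      >>= λ filled → pure (to-face filled)
      where
      to-face : Fills (YFace (∁ T) (suc d)) (bd b) → Fills (Face T (suc d)) z
      to-face (y , y-supp , ∂y) = y , supp , λ τ → trans (∂y τ) (∂b≡z τ)
        where
        supp : Supp (Face T (suc d)) y
        supp σ ≢0 = let Yσ , σ⊆ , ∣σ∣ = y-supp σ ≢0 in σ⊆ , ∣σ∣ , Yσ , ⊥-elim ∘ ℕ.1+n≰n
  fill-face {T} (suc i) {z} YT ∂z≡0 z-supp | tri> _ _ d<s =
    leray (∁ T) i (s≤s⁻¹ d<s) z
      (λ σ ≢0 → let σ⊆ , ∣σ∣ , Yσ , _ = z-supp σ ≢0 in Yσ , (λ {_} → σ⊆) , ∣σ∣) ∂z≡0 >>=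
    λ filled → pure (to-face filled)
    where
    to-face : (∃ λ (b : Chain n) → IsChain Y (∁ T) (suc i) b × (∀ τ → bd b τ ≡ z τ)) →
              Fills (Face T (suc (suc i))) z
    to-face (b , b-supp , ∂b≡z) = b , supp , ∂b≡z
      where
      supp : Supp (Face T (suc (suc i))) b
      supp σ ≢0 = let Yσ , σ⊆ , ∣σ∣ = b-supp σ ≢0 in
        σ⊆ , ∣σ∣ , Yσ , λ s≤d → ⊥-elim (ℕ.<⇒≱ d<s (ℕ.≤-trans (ℕ.n≤1+n _) s≤d))

  -- The boundary prescribed for the image of the cell c: that of the cube c, augmented on vertices.
  prescribed : (Cell n → Chain n) → Cell n → Chain n
  prescribed f c τ = ∇ (λ c′ → f c′ τ) c ℚ.+ isVertex c * single ⊥ τ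

  prescribed-cong : ∀ {f g : Cell n → Chain n} c → (∀ c′ → c′ ◁ c → ∀ τ → f c′ τ ≡ g c′ τ) →
                    ∀ τ → prescribed f c τ ≡ prescribed g c τ
  prescribed-cong c f≗g τ = cong (ℚ._+ isVertex c * single ⊥ τ) (∇-cong c (λ c′ c′◁c → f≗g c′ c′◁c τ))

  prescribed-cycle : ∀ f c → (∀ c′ → c′ ◁ c → ∀ τ → bd (f c′) τ ≡ prescribed f c′ τ) →
                     Cycle (prescribed f c)
  prescribed-cycle f c ∂f τ = begin
    bd (prescribed f c) τ
      ≡⟨ bd-+ (λ σ → ∇ (λ c′ → f c′ σ) c) _ τ ⟩
    bd (λ σ → ∇ (λ c′ → f c′ σ) c) τ ℚ.+ bd (λ σ → isVertex c * single ⊥ σ) τ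
      ≡⟨ cong₂ ℚ._+_ (bd-∇ f c τ)
           (trans (bd-* (isVertex c) (single ⊥) τ) (cong (isVertex c *_) (bd-single-⊥ τ))) ⟩
    ∇ (λ c′ → bd (f c′) τ) c ℚ.+ isVertex c * 0ℚ
      ≡⟨ cong₂ ℚ._+_ (∇-cong c (λ c′ c′◁c → ∂f c′ c′◁c τ)) (ℚ.*-zeroʳ (isVertex c)) ⟩
    ∇ (λ c′ → prescribed f c′ τ) c ℚ.+ 0ℚ
      ≡⟨ cong (ℚ._+ 0ℚ) (∇-+ (∇ (λ c′ → f c′ τ)) (λ c′ → isVertex c′ * single ⊥ τ) c) ⟩
    ∇ (∇ (λ c′ → f c′ τ)) c ℚ.+ ∇ (λ c′ → isVertex c′ * single ⊥ τ) c ℚ.+ 0ℚ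
      ≡⟨ cong₂ (λ a b → a ℚ.+ b ℚ.+ 0ℚ) (∇-∇ (λ c′ → f c′ τ) c) (∇-isVertex (single ⊥ τ) c) ⟩
    0ℚ ∎
    where open ≡-Reasoning

  Supported : Cell n → Chain n → Set
  Supported c = Supp (λ σ → Y (top c) × Face (bot c) (suc (dim c)) σ)

  Good : ℕ → (Cell n → Chain n) → Set
  Good N f = ∀ c → dim c < N → Supported c (f c) × (Y (top c) → ∀ τ → bd (f c) τ ≡ prescribed f c τ)

  prescribed-supp : ∀ {N f} → Good N f → ∀ c → dim c ≡ N → Y (top c) →
                    Supp (Face (bot c) N) (prescribed f c)
  prescribed-supp {N} {f} good c dim≡ Ytop σ = +-≢0 (∇ (λ c′ → f c′ σ) c) _ from-∇ from-vertex
    where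
    from-∇ : ¬ ∇ (λ c′ → f c′ σ) c ≡ 0ℚ → Face (bot c) N σ
    from-∇ ≢0 = from-facet (∇-supp (λ c′ → f c′ σ) c ≢0)
      where
      from-facet : (∃ λ c′ → c′ ◁ c × ¬ f c′ σ ≡ 0ℚ) → Face (bot c) N σ
      from-facet (c′ , c′◁c , ≢0) =
        let dim′ = trans (sym (◁-dim c′◁c)) dim≡
            _ , σ⊆ , ∣σ∣ , Yσ , Gσ = proj₁ (good c′ (ℕ.≤-reflexive dim′)) σ ≢0
        in (λ y∈ → p⊆q⇒∁p⊇∁q (◁-bot c′◁c) (σ⊆ y∈)) , trans ∣σ∣ dim′ , Yσ ,
           λ N≤d → Gσ (subst (_≤ d) (sym dim′) N≤d)
    from-vertex : ¬ isVertex c * single ⊥ σ ≡ 0ℚ → Face (bot c) N σ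
    from-vertex ≢0 with single-supp ⊥ σ (*-≢0ʳ (isVertex c) (single ⊥ σ) ≢0)
    ... | refl = (λ {_} → ⊥⊆) ,
      trans (∣⊥∣≡0 n) (trans (sym (isVertex-≢0 c (*-≢0ˡ (isVertex c) (single ⊥ σ) ≢0))) dim≡) ,
      Y-⊥ , λ _ → G-⊥

  extend-good : ∀ {N f} → Good N f → K {R} (∃ (Good (suc N)))
  extend-good {N} {f} good = seqCell new >>= λ g → pure (combine g)
    where
    New : Cell n → Set
    New c = ∃ λ (g : Chain n) → dim c ≡ N → Supported c g × (Y (top c) → ∀ τ → bd g τ ≡ prescribed f c τ)
    new : ∀ c → K {R} (New c)
    new c with dim c ℕ.≟ N | Y? (top c)
    ... | no ≢N    | _ = pure ((λ _ → 0ℚ) , λ ≡N → ⊥-elim (≢N ≡N))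
    ... | yes _    | no ¬Ytop =
      pure ((λ _ → 0ℚ) , λ _ → (λ _ ≢0 → ⊥-elim (≢0 refl)) , λ Ytop → ⊥-elim (¬Ytop Ytop))
    ... | yes refl | yes Ytop =
      fill-face (dim c) (Y-⊆ _ _ (bot⊆top c) Ytop)
        (prescribed-cycle f c λ c′ c′◁c →
          proj₂ (good c′ (ℕ.≤-reflexive (sym (◁-dim c′◁c)))) (Y-⊆ _ _ (◁-top c′◁c) Ytop))
        (prescribed-supp {f = f} good c refl Ytop) >>= λ (g , g-supp , ∂g) →
      pure (g , λ _ → (λ σ ≢0 → Ytop , g-supp σ ≢0) , λ _ → ∂g)
    combine : (∀ c → New c) → ∃ (Good (suc N))
    combine g = f⁺ , good⁺
      where
      f⁺ : Cell n → Chain n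
      f⁺ c with dim c ℕ.≟ N
      ... | yes _ = proj₁ (g c)
      ... | no  _ = f c
      f⁺-old : ∀ c → dim c < N → f⁺ c ≡ f c
      f⁺-old c dim< with dim c ℕ.≟ N
      ... | yes eq = ⊥-elim (ℕ.<-irrefl eq dim<)
      ... | no _   = refl
      unchanged : ∀ c → dim c ≤ N → ∀ τ → prescribed f c τ ≡ prescribed f⁺ c τ
      unchanged c dim≤ = prescribed-cong c λ c′ c′◁c τ →
        cong (λ h → h τ) (sym (f⁺-old c′ (subst (_≤ N) (◁-dim c′◁c) dim≤)))
      good⁺ : Good (suc N) f⁺
      good⁺ c dim< with dim c ℕ.≟ N
      ... | yes eq = let supp , ∂g = proj₂ (g c) eq in
                     supp , λ Ytop τ → trans (∂g Ytop τ) (unchanged c (s≤s⁻¹ dim<) τ)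
      ... | no ≢N  = let supp , ∂f = good c (ℕ.≤∧≢⇒< (s≤s⁻¹ dim<) ≢N) in
                     supp , λ Ytop τ → trans (∂f Ytop τ) (unchanged c (s≤s⁻¹ dim<) τ)

  good-exists : ∀ N → K {R} (∃ (Good N))
  good-exists zero    = pure ((λ _ _ → 0ℚ) , λ _ ())
  good-exists (suc N) = good-exists N >>= λ (_ , good) → extend-good good

  no-good : ∀ f → ¬ Good (suc n) f
  no-good f good = 0≢1 (begin
    0ℚ                                             ≡⟨ sym (ℚ.+-inverseʳ (sumS D₁)) ⟩
    sumS D₁ ℚ.+ - sumS D₁
      ≡⟨ cong₂ (λ a b → a ℚ.+ - b) (sumS-cong D₁≡) (trace H) ⟩
    sumS (λ τ → D₂ τ ℚ.+ single ⊥ τ) ℚ.+ - sumS D₂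
      ≡⟨ cong (ℚ._+ - sumS D₂) (sumS-+ D₂ (single ⊥)) ⟩
    sumS D₂ ℚ.+ sumS {n} (single ⊥) ℚ.+ - sumS D₂  ≡⟨ cancel (sumS D₂) _ ⟩
    sumS {n} (single ⊥)                            ≡⟨ sumS-single-⊥ n ⟩
    1ℚ                                             ∎)
    where
    open ≡-Reasoning
    0≢1 : ¬ 0ℚ ≡ 1ℚ
    0≢1 ()
    cancel : ∀ a b → a ℚ.+ b ℚ.+ - a ≡ b
    cancel = solve-∀ ℚ-ring
    H : Subset n → Chain n
    H τ = f (fullCube τ)
    D₁ D₂ : Subset n → ℚ
    D₁ τ = bd (H τ) τ
    D₂ τ = cobd (λ τ′ → H τ′ τ) τ
    supported : ∀ c → Supported c (f c)
    supported c = proj₁ (good c (s≤s (dim≤n c)))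
    D₁≡ : ∀ τ → D₁ τ ≡ D₂ τ ℚ.+ single ⊥ τ
    D₁≡ τ with Y? τ
    ... | yes Yτ = trans
      (proj₂ (good (fullCube τ) (s≤s (dim≤n (fullCube τ)))) (subst Y (sym (top-fullCube τ)) Yτ) τ)
      (cong₂ ℚ._+_ (∇-fullCube (λ c → f c τ) τ λ c x x∈bot x∈τ → ≡0-stable λ ≢0 →
                   x∈∁p⇒x∉p (proj₁ (proj₂ (supported c τ ≢0)) x∈τ) x∈bot)
                 (trans (cong (_* single ⊥ τ) (isVertex-fullCube τ)) (single-idem ⊥ τ)))
    ... | no ¬Yτ = trans (trans (bd-cong Hτ≡0 τ) (bd-0 τ)) (sym (cong₂ ℚ._+_ (cobd-0 H-τ≡0 τ) single≡0))
      where
      Hτ≡0 : ∀ σ → H τ σ ≡ 0ℚ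
      Hτ≡0 σ = ≡0-stable λ ≢0 → ¬Yτ (subst Y (top-fullCube τ) (proj₁ (supported (fullCube τ) σ ≢0)))
      H-τ≡0 : ∀ τ′ → H τ′ τ ≡ 0ℚ
      H-τ≡0 τ′ = ≡0-stable λ ≢0 → ¬Yτ (proj₁ (proj₂ (proj₂ (proj₂ (supported (fullCube τ′) τ ≢0)))))
      single≡0 : single ⊥ τ ≡ 0ℚ
      single≡0 = ≡0-stable λ ≢0 → ¬Yτ (subst Y (sym (single-supp ⊥ τ ≢0)) Y-⊥)

  contradiction-in-R : R
  contradiction-in-R = good-exists (suc n) λ (f , good) → ⊥-elim (no-good f good)

IsLeft : {A B : Set} → A ⊎ B → Set
IsLeft (inj₁ _) = Unit
IsLeft (inj₂ _) = Empty.⊥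

theorem1p7 : (d r m k n : ℕ) →
    1 ≤ d → d + 1 ≤ r → 1 ≤ m → m ≤ r → m ≤ k → k ≤ m + d → k ≤ r →
    m + d ≤ n → r ≤ n →
    (X : Subset n → Set) → IsSimplicialComplex X → IsLeray X d →
    (I : Subset n → Bool) → IsMatroid I → rank I ⊤ ≡ r →
    (∀ (A B : Subset n) → Empty (A ∩ B) → ∣ A ∣ ≡ d + 1 → ∣ B ∣ ≡ m ∸ 1 →
    k ≤ rank I (A ∪ B) →
    X A ⊎ ∃ (λ v → v ∈ B × (∀ σ → σ ⊂ A → X (σ ∪ ⁅ v ⁆)))) →
    ∃ (λ τ → X τ × rank I (∁ τ) ≤ k ∸ 1)
theorem1p7 d r m k n 1≤d d+1≤r 1≤m m≤r m≤k k≤m+d k≤r m+d≤n r≤n X X-⊆ X-leray I I-matroid rank≡r X-hyp =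
  seqSubset decide main
  where
  R : Set
  R = ∃ λ τ → X τ × rank I (∁ τ) ≤ k ∸ 1

  decide : ∀ σ → K {R} (X σ ⊎ (X σ → R))
  decide σ ret = ret (inj₂ λ Xσ → ret (inj₁ Xσ))

  when : ∀ {P Q : Set} → Dec P → (P → K {R} Q) → K {R} (P → Q)
  when (yes p) f = f p >>= λ q → pure λ _ → q
  when (no ¬p) f = pure λ p → ⊥-elim (¬p p)

  main : (∀ σ → X σ ⊎ (X σ → R)) → R
  main X? =
    seqSubset (λ σ → seqSubset (closed σ)) λ Y-⊆ →
    seqSubset (λ A → seqSubset (λ B → hyp A B)) λ Y-hyp →
    seqSubset large λ Y-large →
    Core.contradiction-in-R {R} d m k n 1≤m m≤k (subst (k ≤_) (ℕ.+-comm m d) k≤m+d)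
      (subst (_≤ n) (ℕ.+-comm m d) m+d≤n) I I-matroid (subst (k ≤_) (sym rank≡r) k≤r)
      Y Y? (λ σ τ σ⊆τ → Y-⊆ σ τ σ⊆τ) leray
      (λ A B disj ∣A∣ ∣B∣ k≤ρ → Y-hyp A B (disj , ∣A∣ , ∣B∣ , k≤ρ)) Y-large
    where
    Y : Subset n → Set
    Y σ = IsLeft (X? σ)

    Y? : Decidable Y
    Y? σ with X? σ
    ... | inj₁ _ = yes tt
    ... | inj₂ _ = no λ ()

    Y⇒X : ∀ {σ} → Y σ → X σ
    Y⇒X {σ} Yσ with X? σ
    ... | inj₁ Xσ = Xσ

    X⇒Y : ∀ {σ} → X σ → K {R} (Y σ)
    X⇒Y {σ} Xσ with X? σ
    ... | inj₁ _  = pure tt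
    ... | inj₂ ¬X = λ _ → ¬X Xσ

    closed : ∀ σ τ → K {R} (σ ⊆ τ → Y τ → Y σ)
    closed σ τ ret with σ ⊆? τ | Y? τ
    ... | no  σ⊈τ | _      = ret λ σ⊆τ → ⊥-elim (σ⊈τ σ⊆τ)
    ... | yes _   | no ¬Yτ = ret λ _ Yτ → ⊥-elim (¬Yτ Yτ)
    ... | yes σ⊆τ | yes Yτ = X⇒Y (X-⊆ σ τ σ⊆τ (Y⇒X Yτ)) λ Yσ → ret λ _ _ → Yσ

    hyp : ∀ A B → K {R} (Empty (A ∩ B) × ∣ A ∣ ≡ suc d × ∣ B ∣ ≡ m ∸ 1 × k ≤ rank I (A ∪ B) →
                    Y A ⊎ ∃ λ v → v ∈ B × (∀ σ → σ ⊂ A → Y (σ ∪ ⁅ v ⁆)))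
    hyp A B =
      when (¬? (nonempty? (A ∩ B)) ×-dec (∣ A ∣ ℕ.≟ suc d) ×-dec (∣ B ∣ ℕ.≟ m ∸ 1) ×-dec
            (k ≤? rank I (A ∪ B)))
      λ (disj , ∣A∣ , ∣B∣ , k≤ρ) → transfer (X-hyp A B disj (trans ∣A∣ (ℕ.+-comm 1 d)) ∣B∣ k≤ρ)
      where
      transfer : X A ⊎ (∃ λ v → v ∈ B × (∀ σ → σ ⊂ A → X (σ ∪ ⁅ v ⁆))) →
                 K {R} (Y A ⊎ ∃ λ v → v ∈ B × (∀ σ → σ ⊂ A → Y (σ ∪ ⁅ v ⁆)))
      transfer (inj₁ XA)               ret = X⇒Y XA (ret ∘ inj₁)
      transfer (inj₂ (v , v∈B , v-ok)) ret =
        seqSubset (λ σ → when (σ ⊂? A) (X⇒Y ∘ v-ok σ)) λ v-ok′ → ret (inj₂ (v , v∈B , v-ok′))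

    large : ∀ τ → K {R} (Y τ → k ≤ rank I (∁ τ))
    large τ with k ≤? rank I (∁ τ)
    ... | yes k≤ρ = pure λ _ → k≤ρ
    ... | no  k≰ρ = when (Y? τ) λ Yτ _ → τ , Y⇒X Yτ , ℕ.∸-monoˡ-≤ 1 (ℕ.≰⇒> k≰ρ)

    leray : ∀ U i → d ≤ i → (c : Chain n) → IsChain Y U i c → Cycle c →
            K {R} (∃ λ (b : Chain n) → IsChain Y U (suc i) b × (∀ τ → bd b τ ≡ c τ))
    leray U i d≤i c c-chain ∂c≡0 = transfer
      (X-leray U i d≤i c (λ σ ≢0 → let Yσ , rest = c-chain σ ≢0 in Y⇒X Yσ , rest)
               (λ τ → trans (∂≡bd c τ) (∂c≡0 τ)))
      where
      transfer : (∃ λ (b : Chain n) → IsChain X U (suc i) b × (∀ τ → ∂ b τ ≡ c τ)) →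
                 K {R} (∃ λ (b : Chain n) → IsChain Y U (suc i) b × (∀ τ → bd b τ ≡ c τ))
      transfer (b , b-chain , ∂b) ret =
        seqSubset (λ σ → when (¬? (b σ ℚ.≟ 0ℚ)) (λ ≢0 → X⇒Y (proj₁ (b-chain σ ≢0)))) λ bY →
        ret (b , (λ σ ≢0 → bY σ ≢0 , proj₂ (b-chain σ ≢0)) , λ τ → trans (sym (∂≡bd b τ)) (∂b τ))
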